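{- Let $r_1,\ldots,r_s$ be positive integers and let $G$ be a $2$-connected nonhamiltonian graph of order $n$, circumference $c$ and minimum degree $\delta(G)\ge k$. Then $$N(K_{r_1,\ldots,r_s},G)\le \max\{g_{r_1,\ldots,r_s}(n,c,k),\ g_{r_1,\ldots,r_s}(n,c,\lfloor c/2\rfloor)\}.$$
   Context: The circumference of a graph is the length of a longest cycle in it. For positive integers $r_1,\ldots,r_s$, $K_{r_1,\ldots,r_s}$ denotes the complete multipartite graph with $s$ parts of sizes $r_1,\ldots,r_s$. For graphs $H$ and $G$, $N(H,G)$ denotes the number of subgraphs of $G$ isomorphic to $H$ (copies of $H$ in $G$). For integers $n,c,k$ with $k\ge 0$ and $n-1\ge c\ge 2k$, let $G(n,c,k)=K_k\vee\left(K_{c+1-2k}+\overline{K_{n-c-1+k}}\right)$, where $\vee$ denotes the join of two graphs (disjoint union plus all edges between them), $+$ denotes disjoint union, $K_m$ is the complete graph on $m$ vertices ($K_0$ being the empty graph), and $\overline{K_m}$ is the edgeless graph on $m$ vertices. Define $g_{r_1,\ldots,r_s}(n,c,k)=N(K_{r_1,\ldots,r_s},G(n,c,k))$. -}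

module Defs where

open import Data.Nat using (ℕ; zero; suc; _+_; _∸_; _≤_; _<ᵇ_; _≡ᵇ_)
open import Data.Bool using (Bool; true; false; not; _∧_; _∨_; if_then_else_)
open import Data.Fin using (Fin; toℕ; fromℕ; inject₁; splitAt) renaming (zero to fzero; suc to fsuc)
import Data.Fin as F
open import Data.List using (List; []; _∷_; map; allFin; length)
open import Data.Nat.ListAction using (sum)
open import Data.Empty using (⊥)
open import Data.List.Relation.Unary.All using (All)
open import Data.List.Relation.Unary.Unique.Propositional using (Unique)
open import Data.List.Membership.Propositional using (_∈_)
open import Data.Vec using (Vec; lookup)
open import Data.Product using (Σ; ∃; _×_; _,_)
open import Data.Sum using (_⊎_; inj₁; inj₂)
open import Function.Bundles using (_⇔_)
open import Relation.Binary.PropositionalEquality using (_≡_)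
open import Relation.Nullary.Decidable using (⌊_⌋)

Graph : ℕ → Set
Graph n = Fin n → Fin n → Bool

IsSimple : {n : ℕ} → Graph n → Set
IsSimple {n} G = (∀ u v → G u v ≡ G v u) × (∀ v → G v v ≡ false)

Injective : {m n : ℕ} → (Fin m → Fin n) → Set
Injective f = ∀ i j → f i ≡ f j → i ≡ j

degree : {n : ℕ} → Graph n → Fin n → ℕ
degree {n} G v = sum (map (λ u → if G v u then 1 else 0) (allFin n))

MinDegreeAtLeast : {n : ℕ} → Graph n → ℕ → Set
MinDegreeAtLeast {n} G k = ∀ v → k ≤ degree G v

IsCycle : {n : ℕ} → Graph n → (L : ℕ) → (Fin L → Fin n) → Set
IsCycle G L f =
  (3 ≤ L) × Injective f ×
  (∀ i j → (toℕ j ≡ suc (toℕ i) ⊎ (toℕ i ≡ L ∸ 1 × toℕ j ≡ 0)) → G (f i) (f j) ≡ true)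

HasCycleOfLength : {n : ℕ} → Graph n → ℕ → Set
HasCycleOfLength G L = Σ (Fin _ → Fin _) λ f → IsCycle G L f

Circumference : {n : ℕ} → Graph n → ℕ → Set
Circumference G c = HasCycleOfLength G c × (∀ L → HasCycleOfLength G L → L ≤ c)

Hamiltonian : {n : ℕ} → Graph n → Set
Hamiltonian {n} G = HasCycleOfLength G n

WalkWithin : {n : ℕ} → Graph n → (Fin n → Set) → Fin n → Fin n → Set
WalkWithin {n} G P u v =
  Σ ℕ λ l → Σ (Fin (suc l) → Fin n) λ w →
    (w fzero ≡ u) × (w (fromℕ l) ≡ v) × (∀ i → P (w i)) ×
    (∀ (i : Fin l) → G (w (inject₁ i)) (w (fsuc i)) ≡ true)

ConnectedWithin : {n : ℕ} → Graph n → (Fin n → Set) → Set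
ConnectedWithin {n} G P = ∀ u v → P u → P v → WalkWithin G P u v

TwoConnected : {n : ℕ} → Graph n → Set
TwoConnected {n} G = (3 ≤ n) × (∀ x → ConnectedWithin G (λ v → v ≡ x → ⊥))

partOf : (rs : List ℕ) → Fin (sum rs) → ℕ
partOf [] ()
partOf (r ∷ rs) v with splitAt r v
... | inj₁ _ = 0
... | inj₂ w = suc (partOf rs w)

CompleteMultipartite : (rs : List ℕ) → Graph (sum rs)
CompleteMultipartite rs i j = not (partOf rs i ≡ᵇ partOf rs j)

-- a subgraph of a graph on Fin n: vertex set and edge set (adjacency matrix)
SubG : ℕ → Set
SubG n = Vec Bool n × Vec (Vec Bool n) n

-- (S , E) is a subgraph of G isomorphic to H: it is the image of an
-- injective homomorphism f : H → G (vertices f(V(H)), edges f(E(H))).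
IsCopy : {m n : ℕ} → Graph m → Graph n → SubG n → Set
IsCopy {m} {n} H G (S , E) =
  Σ (Fin m → Fin n) λ f →
    Injective f ×
    (∀ i j → H i j ≡ true → G (f i) (f j) ≡ true) ×
    (∀ v → (lookup S v ≡ true) ⇔ (∃ λ i → f i ≡ v)) ×
    (∀ u v → (lookup (lookup E u) v ≡ true) ⇔
               (∃ λ i → ∃ λ j → f i ≡ u × f j ≡ v × H i j ≡ true))

NumCopies : {m n : ℕ} → Graph m → Graph n → ℕ → Set
NumCopies {m} {n} H G N =
  Σ (List (SubG n)) λ L →
    Unique L × All (IsCopy H G) L × (∀ x → IsCopy H G x → x ∈ L) × length L ≡ N

-- G(n,c,k) = K_k ∨ (K_{c+1-2k} + independent set on n-c-1+k vertices), on Fin n: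
-- vertices 0..k-1 form K_k, vertices k..c-k form K_{c+1-2k}, the rest are independent.
Gnck : (n c k : ℕ) → Graph n
Gnck n c k u v =
  not ⌊ u F.≟ v ⌋ ∧ (inA u ∨ inA v ∨ (inB u ∧ inB v))
  where
    inA : Fin n → Bool
    inA x = toℕ x <ᵇ k
    inB : Fin n → Bool
    inB x = not (inA x) ∧ (toℕ x <ᵇ (c + 1 ∸ k))

module Submission where

-- Adding edges uv for which no uv-path has c or more edges keeps all cycles at length at most
-- c, so G has a supergraph in which any two nonadjacent vertices are joined by such a path. By
-- Kopylov's lemma the ends of a path with c or more edges have at most c neighbours on it in
-- total. Applied to longest paths, this shows that, for t = ⌊c/2⌋, either deleting vertices of
-- degree at most t exhausts the graph, or what remains is a clique with r ≤ c + 1 ∸ k vertices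
-- and all other vertices can be deleted at degree at most s = c + 1 ∸ r, where k ≤ s ≤ t. In a
-- copy of a complete multipartite graph every edge has an end adjacent to any prescribed
-- vertex of the copy. Hence, sending the later neighbours of the first deleted vertex of a
-- copy into the dominating clique of G(n,c,s) maps copies to copies, injectively. Finally s ↦
-- N(K, G(n,c,s)) is convex, which leaves s = k and s = t.

-- The supergraph serves only to find the order of deletion. Degree bounds pass to subgraphs, so the
-- same order serves `G`, and copies are counted in `G` itself. Each use of longest paths is a sum
-- of two degree bounds exceeding c: (t+1)+(t+1) makes the remaining core a clique on r vertices;
-- k+(r-1) > c would join every deleted vertex to the whole clique, hence k+r is at most c+1; and
-- (s+1)+(r-1) = c+1 shows that a second deletion, at degree at most s, exhausts everything outside
-- the clique. `G` need not embed in G(n,c,s), so no single relabelling of the vertices works. The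
-- relabelling depends on the first deleted vertex of the copy and can be read off the highest
-- vertex of the image. Convexity needs no formula for N(K, G(n,c,s)): the copies in G(n,c,s) and in
-- a second, isomorphic placement of it are distributed over G(n,c,s-1) and G(n,c,s+1). The
-- supergraph and the intermediate counts are obtained only under a double negation, which is
-- harmless because an inequality between numbers is decidable.

open import Defs
import Algebra.Solver.CommutativeMonoid as CMSolver
open import Data.Bool using (Bool; true; false; not; _∧_; _∨_; if_then_else_) renaming (T to IsTrue)
open import Data.Bool.Properties using () renaming (_≟_ to _≟ᵇ_)
open import Data.Empty using (⊥; ⊥-elim)
import Data.Fin as F
open import Data.Fin using (Fin; toℕ; fromℕ; inject₁; fromℕ<; cast) renaming (zero to fzero; suc to fsuc)
open import Data.Fin.Permutation using (Permutation′; permutation; _⟨$⟩ʳ_; _⟨$⟩ˡ_; inverseˡ; inverseʳ; transpose; _∘ₚ_)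
open import Data.Fin.Properties using (injective⇒≤; toℕ-injective; toℕ-fromℕ<; toℕ-cast; any?)
open import Data.List using (List; []; _∷_; _++_; map; allFin; length; take; drop; lookup; filter; cartesianProduct; cartesianProductWith)
import Data.List.Membership.DecPropositional as DecMembership
open import Data.List.Membership.Propositional using (_∈_; _∉_)
open import Data.List.Membership.Propositional.Properties using (∈-++⁺ˡ; ∈-++⁺ʳ; ∈-++⁻; ∈-∃++; ∈-allFin; ∈-lookup; ∈-cartesianProduct⁺; ∈-filter⁺; ∈-filter⁻; ∈-cartesianProductWith⁺)
open import Data.List.Properties using (++-assoc; length-++; ++-identityʳ; length-tabulate; take++drop≡id; length-drop)
open import Data.List.Relation.Binary.Permutation.Propositional using (_↭_; ↭-refl; ↭-sym; ↭-trans; prep; swap; ↭⇒↭ₛ; ↭-reflexive)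
open import Data.List.Relation.Binary.Permutation.Propositional.Properties using (∈-resp-↭; ↭-length; shift; map⁺; ++⁺; ++⁺ˡ; ++⁺ʳ; ++-comm; ++-commutativeMonoid)
import Data.List.Relation.Binary.Permutation.Setoid.Properties as PermSetoid
import Data.List.Relation.Unary.All as All
open import Data.List.Relation.Unary.All using (All; []; _∷_)
open import Data.List.Relation.Unary.All.Properties using (¬Any⇒All¬)
open import Data.List.Relation.Unary.AllPairs using ([]; _∷_)
open import Data.List.Relation.Unary.Any using (here; there)
open import Data.List.Relation.Unary.Unique.Propositional using (Unique)
import Data.List.Relation.Unary.Unique.Propositional.Properties as Uniqueₚ
open import Data.Nat using (ℕ; zero; suc; _+_; _*_; _∸_; _≤_; _<_; _⊔_; _/_; z≤n; s≤s; _<ᵇ_; _≡ᵇ_; _%_)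
open import Data.Nat.DivMod using (m≡m%n+[m/n]*n; m%n<n; m/n*n≤m)
open import Data.Nat.ListAction using (sum)
open import Data.Nat.ListAction.Properties using (sum-↭)
open import Data.Nat.Properties
open import Data.Nat.Tactic.RingSolver using (solve-∀)
open import Data.Product using (∃; ∃₂; _×_; _,_; proj₁; proj₂)
import Data.Product.Properties as Productₚ
open import Data.Sum using (_⊎_; inj₁; inj₂; [_,_]′)
import Data.Vec as Vec
open import Data.Vec using (Vec; tabulate) renaming (lookup to lookupᵥ)
import Data.Vec.Properties as Vecₚ
open import Function using (_∘_; id; case_of_)
open import Function.Bundles using (mk⇔; Equivalence)
open import Relation.Binary.Definitions using (tri<; tri≈; tri>)
open import Relation.Binary.PropositionalEquality using (_≡_; _≢_; refl; sym; trans; cong; cong₂; subst; subst₂; setoid; module ≡-Reasoning)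
open import Relation.Nullary using (¬_; Dec; yes; no)
open import Relation.Nullary.Decidable using (⌊_⌋; decidable-stable; ¬?; ¬¬-excluded-middle; _×-dec_)
open import Relation.Unary using (Decidable)

-- Lists and walks

Unique-↭ : {A : Set} {xs ys : List A} → xs ↭ ys → Unique xs → Unique ys
Unique-↭ p = PermSetoid.Unique-resp-↭ (setoid _) (↭⇒↭ₛ p)

head-∉ : {A : Set} {x : A} {xs : List A} → Unique (x ∷ xs) → x ∉ xs
head-∉ = Uniqueₚ.Unique[x∷xs]⇒x∉xs

tail-! : {A : Set} {x : A} {xs : List A} → Unique (x ∷ xs) → Unique xs
tail-! (_ ∷ u) = u

cons-! : {A : Set} {x : A} {xs : List A} → x ∉ xs → Unique xs → Unique (x ∷ xs)
cons-! x∉xs u = ¬Any⇒All¬ _ x∉xs ∷ u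

++-! : {A : Set} {xs ys : List A} → Unique xs → Unique ys →
  (∀ {v} → v ∈ xs → v ∈ ys → ⊥) → Unique (xs ++ ys)
++-! u w d = Uniqueₚ.++⁺ u w λ { (p , q) → d p q }

++-!⁻ : {A : Set} (xs : List A) {ys : List A} → Unique (xs ++ ys) →
  Unique xs × Unique ys × (∀ {v} → v ∈ xs → v ∈ ys → ⊥)
++-!⁻ []       u = [] , u , λ ()
++-!⁻ (x ∷ xs) u with ++-!⁻ xs (tail-! u)
... | uxs , uys , d =
  cons-! (head-∉ u ∘ ∈-++⁺ˡ) uxs , uys ,
  λ { (here refl) q → head-∉ u (∈-++⁺ʳ xs q) ; (there p) q → d p q }

-- `degree G v` unfolds to `count (G v) (allFin n)`, so one notion covers degrees and numbers of
-- neighbours on a path or in a set.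
count : {A : Set} → (A → Bool) → List A → ℕ
count p xs = sum (map (λ u → if p u then 1 else 0) xs)

module _ {A : Set} (p : A → Bool) where

  count-++ : ∀ xs ys → count p (xs ++ ys) ≡ count p xs + count p ys
  count-++ []       ys = refl
  count-++ (x ∷ xs) ys =
    trans (cong ((if p x then 1 else 0) +_) (count-++ xs ys)) (sym (+-assoc (if p x then 1 else 0) _ _))

  count-↭ : ∀ {xs ys} → xs ↭ ys → count p xs ≡ count p ys
  count-↭ q = sum-↭ (map⁺ _ q)

  count-true : ∀ {x} xs → p x ≡ true → count p (x ∷ xs) ≡ suc (count p xs)
  count-true xs e rewrite e = refl

  count-false : ∀ {x} xs → p x ≡ false → count p (x ∷ xs) ≡ count p xs
  count-false xs e rewrite e = refl

  count-∷≤ : ∀ x xs → count p (x ∷ xs) ≤ suc (count p xs)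
  count-∷≤ x xs with p x
  ... | true  = ≤-refl
  ... | false = n≤1+n _

  count≤∷ : ∀ x xs → count p xs ≤ count p (x ∷ xs)
  count≤∷ x xs = m≤n+m _ (if p x then 1 else 0)

  count≤length : ∀ xs → count p xs ≤ length xs
  count≤length []       = z≤n
  count≤length (x ∷ xs) = ≤-trans (count-∷≤ x xs) (s≤s (count≤length xs))

  count-none : ∀ xs → (∀ {v} → v ∈ xs → p v ≡ false) → count p xs ≡ 0
  count-none []       h = refl
  count-none (x ∷ xs) h = trans (count-false xs (h (here refl))) (count-none xs (h ∘ there))

  count-all : ∀ xs → (∀ {v} → v ∈ xs → p v ≡ true) → count p xs ≡ length xs
  count-all []       h = refl
  count-all (x ∷ xs) h = trans (count-true xs (h (here refl))) (cong suc (count-all xs (h ∘ there)))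

  count-⊆ : ∀ {xs ys} → Unique xs → (∀ {v} → v ∈ xs → p v ≡ true → v ∈ ys) → count p xs ≤ count p ys
  count-⊆ {[]}     _ _ = z≤n
  count-⊆ {x ∷ xs} {ys} u h with p x in eq
  ... | false = count-⊆ (tail-! u) (h ∘ there)
  ... | true with ∈-∃++ (h (here refl) eq)
  ... | l₁ , l₂ , refl = begin
    suc (count p xs)         ≤⟨ s≤s (count-⊆ (tail-! u) h′) ⟩
    suc (count p (l₁ ++ l₂)) ≡⟨ sym (count-true (l₁ ++ l₂) eq) ⟩
    count p (x ∷ l₁ ++ l₂)   ≡⟨ sym (count-↭ (shift x l₁ l₂)) ⟩
    count p (l₁ ++ x ∷ l₂)   ∎
    where
    open ≤-Reasoning
    h′ : ∀ {v} → v ∈ xs → p v ≡ true → v ∈ l₁ ++ l₂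
    h′ v∈ pv with ∈-resp-↭ (shift x l₁ l₂) (h (there v∈) pv)
    ... | here refl = ⊥-elim (head-∉ u v∈)
    ... | there q   = q

count-mono : {A : Set} {p q : A → Bool} (xs : List A) → (∀ {v} → v ∈ xs → p v ≡ true → q v ≡ true) →
  count p xs ≤ count q xs
count-mono []       h = z≤n
count-mono {p = p} {q} (x ∷ xs) h with p x in eq
... | false = ≤-trans (count-mono xs (h ∘ there)) (count≤∷ q x xs)
... | true rewrite h (here refl) eq = s≤s (count-mono xs (h ∘ there))

length-⊆ : {A : Set} {xs ys : List A} → Unique xs → (∀ {v} → v ∈ xs → v ∈ ys) → length xs ≤ length ys
length-⊆ {xs = xs} {ys} u h = begin
  length xs             ≡⟨ sym (count-all _ xs λ _ → refl) ⟩
  count (λ _ → true) xs ≤⟨ count-⊆ _ u (λ v∈ _ → h v∈) ⟩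
  count (λ _ → true) ys ≤⟨ count≤length _ ys ⟩
  length ys             ∎
  where open ≤-Reasoning

false≢true : {b : Bool} → b ≡ false → b ≡ true → ⊥
false≢true refl ()

≢true⇒false : {b : Bool} → ¬ b ≡ true → b ≡ false
≢true⇒false {true}  h = ⊥-elim (h refl)
≢true⇒false {false} h = refl

-- The last vertex of a walk is not listed, so that walks are concatenated by _++_
-- and a cycle is a closed walk with a duplicate-free list.
data Walk {n : ℕ} (G : Graph n) : Fin n → Fin n → List (Fin n) → Set where
  nil  : ∀ {u} → Walk G u u []
  cons : ∀ {u w v xs} → G u w ≡ true → Walk G w v xs → Walk G u v (u ∷ xs)

-- Duplicate-free closed walks of length 1 or 2 are not cycles, but for `c` at least 2 they are
-- within the bound anyway, so no lower bound on the length is carried along.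
NoCycleAbove : {n : ℕ} → Graph n → ℕ → Set
NoCycleAbove G c = ∀ u xs → Walk G u u xs → Unique xs → c < length xs → ⊥

-- `v` is put in front of `xs` because a walk does not list its last vertex; `length xs` is the
-- number of edges.
record Path {n : ℕ} (G : Graph n) (u v : Fin n) (xs : List (Fin n)) : Set where
  constructor path
  field
    walk   : Walk G u v xs
    unique : Unique (v ∷ xs)
open Path public

module _ {n : ℕ} {G : Graph n} where

  infixr 5 _++ʷ_
  _++ʷ_ : ∀ {u v w xs ys} → Walk G u v xs → Walk G v w ys → Walk G u w (xs ++ ys)
  nil       ++ʷ q = q
  cons e p  ++ʷ q = cons e (p ++ʷ q)

  start∈ : ∀ {u v xs} → Walk G u v xs → u ∈ v ∷ xs
  start∈ nil        = here refl
  start∈ (cons _ _) = there (here refl)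

  split : ∀ {u v x xs} → Walk G u v xs → x ∈ v ∷ xs →
    ∃₂ λ ys zs → xs ≡ ys ++ zs × Walk G u x ys × Walk G x v zs
  split {xs = xs} w (here refl) = xs , [] , sym (++-identityʳ xs) , w , nil
  split w (there x∈) = go w x∈
    where
    go : ∀ {u v x xs} → Walk G u v xs → x ∈ xs →
      ∃₂ λ ys zs → xs ≡ ys ++ zs × Walk G u x ys × Walk G x v zs
    go w@(cons _ _) (here refl) = [] , _ , refl , nil , w
    go (cons {u} e w) (there x∈) with go w x∈
    ... | ys , zs , refl , w₁ , w₂ = u ∷ ys , zs , refl , cons e w₁ , w₂

  reverseʷ : (∀ u v → G u v ≡ G v u) → ∀ {u v xs} → Walk G u v xs →
    ∃ λ ys → Walk G v u ys × u ∷ ys ↭ v ∷ xs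
  reverseʷ G-sym nil = [] , nil , ↭-refl
  reverseʷ G-sym {u} {v} (cons {w = w} {xs = xs} e p) with reverseʷ G-sym p
  ... | ys , q , r =
    ys ++ w ∷ [] , q ++ʷ cons (trans (G-sym w u) e) nil ,
    ↭-trans (prep u (↭-trans (++-comm ys (w ∷ [])) r)) (swap u v ↭-refl)

  simplify : ∀ {u v xs} → Walk G u v xs → ∃ λ ys → Path G u v ys × (∀ {z} → z ∈ ys → z ∈ xs)
  simplify nil = [] , path nil ([] ∷ []) , λ ()
  simplify {u} {v} (cons e w) with simplify w
  ... | ys , path q uq , sub with u F.≟ v
  ... | yes refl = [] , path nil ([] ∷ []) , λ ()
  ... | no  u≢v with DecMembership._∈?_ F._≟_ u ys
  ... | no  u∉ = u ∷ ys , path (cons e q) (Unique-↭ (swap u v ↭-refl) (cons-! (λ { (here p) → u≢v p ; (there p) → u∉ p }) uq)) ,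
                 λ { (here p) → here p ; (there p) → there (sub p) }
  ... | yes u∈ with split q (there u∈)
  ... | ys₁ , ys₂ , refl , _ , q₂ =
    ys₂ , path q₂ (cons-! (head-∉ uq ∘ ∈-++⁺ʳ ys₁) (proj₁ (proj₂ (++-!⁻ ys₁ (tail-! uq))))) ,
    λ p → there (sub (∈-++⁺ʳ ys₁ p))

Walk-mono : {n : ℕ} {G G′ : Graph n} → (∀ u v → G u v ≡ true → G′ u v ≡ true) →
  ∀ {u v xs} → Walk G u v xs → Walk G′ u v xs
Walk-mono le nil        = nil
Walk-mono le (cons e w) = cons (le _ _ e) (Walk-mono le w)

-- Two disjoint paths between two sets

skip-second : {A : Set} {v x y : A} {xs : List A} → v ∈ x ∷ xs → v ∈ x ∷ y ∷ xs
skip-second (here p)  = here p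
skip-second (there p) = there (there p)

NoCutVertex : {n : ℕ} → Graph n → Set
NoCutVertex G = ∀ x u v → u ≢ x → v ≢ x → ∃ λ xs → Walk G u v xs × x ∉ v ∷ xs

_∈?_ : {n : ℕ} (x : Fin n) (xs : List (Fin n)) → Dec (x ∈ xs)
_∈?_ = DecMembership._∈?_ F._≟_

module _ {n : ℕ} (G : Graph n) where

  record Segment (S Y : List (Fin n)) (xs : List (Fin n)) : Set where
    field
      {from to} : Fin n
      {list}    : List (Fin n)
      isPath    : Path G from to list
      from∈     : from ∈ S
      to∈       : to ∈ Y
      avoidsS   : ∀ {v} → v ∈ to ∷ list → v ≡ from ⊎ v ∉ S
      avoidsY   : ∀ {v} → v ∈ list → v ∉ Y
      sub       : ∀ {v} → v ∈ to ∷ list → v ∈ xs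

  record Tail (S Y : List (Fin n)) (xs : List (Fin n)) (from : Fin n) : Set where
    field
      {to}      : Fin n
      {list}    : List (Fin n)
      isPath    : Path G from to list
      to∈       : to ∈ Y
      avoidsS   : ∀ {v} → v ∈ to ∷ list → v ∉ S
      avoidsY   : ∀ {v} → v ∈ list → v ∉ Y
      sub       : ∀ {v} → v ∈ to ∷ list → v ∈ xs

  -- The walk is scanned from its end: a vertex of `Y` restarts the tail, a vertex of `S` completes
  -- a segment, and a vertex already on the tail cuts the tail there.
  segmentOrTail : ∀ S Y {w y xs} → Walk G w y xs → y ∈ Y → Segment S Y (y ∷ xs) ⊎ Tail S Y (y ∷ xs) w
  segmentOrTail S Y {w} nil y∈ with w ∈? S
  ... | yes w∈ = inj₁ record
    { isPath = path nil ([] ∷ []) ; from∈ = w∈ ; to∈ = y∈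
    ; avoidsS = λ { (here p) → inj₁ p } ; avoidsY = λ () ; sub = id }
  ... | no w∉ = inj₂ record
    { isPath = path nil ([] ∷ []) ; to∈ = y∈
    ; avoidsS = λ { (here refl) → w∉ } ; avoidsY = λ () ; sub = id }
  segmentOrTail S Y {w} {y} {xs = .w ∷ xs} (cons e r) y∈ with segmentOrTail S Y r y∈
  ... | inj₁ sg = inj₁ record { Segment sg ; sub = λ p → skip-second (Segment.sub sg p) }
  ... | inj₂ tl with w ∈? Y | w ∈? S
  ... | yes wY | yes wS = inj₁ record
    { isPath = path nil ([] ∷ []) ; from∈ = wS ; to∈ = wY
    ; avoidsS = λ { (here p) → inj₁ p } ; avoidsY = λ () ; sub = λ { (here p) → there (here p) } }
  ... | yes wY | no wS = inj₂ record
    { isPath = path nil ([] ∷ []) ; to∈ = wY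
    ; avoidsS = λ { (here refl) → wS } ; avoidsY = λ () ; sub = λ { (here p) → there (here p) } }
  ... | no wY | yes wS = inj₁ record
    { isPath = path (cons e (walk isPath)) (Unique-↭ (swap w to ↭-refl) (cons-! (λ p → avoidsS p wS) (unique isPath)))
    ; from∈ = wS ; to∈ = to∈
    ; avoidsS = λ { (here p) → inj₂ (avoidsS (here p)) ; (there (here p)) → inj₁ p ; (there (there p)) → inj₂ (avoidsS (there p)) }
    ; avoidsY = λ { (here refl) → wY ; (there p) → avoidsY p }
    ; sub = λ { (here p) → skip-second (sub (here p)) ; (there (here p)) → there (here p) ; (there (there p)) → skip-second (sub (there p)) } }
    where
    open Tail tl
  ... | no wY | no wS with w ∈? (Tail.to tl ∷ Tail.list tl)
  ...   | no w∉ = inj₂ record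
    { isPath = path (cons e (walk isPath)) (Unique-↭ (swap w to ↭-refl) (cons-! w∉ (unique isPath)))
    ; to∈ = to∈
    ; avoidsS = λ { (here p) → avoidsS (here p) ; (there (here refl)) → wS ; (there (there p)) → avoidsS (there p) }
    ; avoidsY = λ { (here refl) → wY ; (there p) → avoidsY p }
    ; sub = λ { (here p) → skip-second (sub (here p)) ; (there (here p)) → there (here p) ; (there (there p)) → skip-second (sub (there p)) } }
    where
    open Tail tl
  ...   | yes w∈ with split (walk (Tail.isPath tl)) w∈
  ...   | ys , zs , eq , _ , r₂ = inj₂ record
    { isPath = path r₂ (cons-! (head-∉ u′ ∘ ∈-++⁺ʳ ys) (proj₁ (proj₂ (++-!⁻ ys (tail-! u′)))))
    ; to∈ = to∈
    ; avoidsS = avoidsS ∘ incl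
    ; avoidsY = avoidsY ∘ incl′
    ; sub = λ p → skip-second (sub (incl p)) }
    where
    open Tail tl
    u′ : Unique (to ∷ ys ++ zs)
    u′ = subst (λ l → Unique (to ∷ l)) eq (unique isPath)
    incl′ : ∀ {v} → v ∈ zs → v ∈ list
    incl′ p = subst (_ ∈_) (sym eq) (∈-++⁺ʳ ys p)
    incl : ∀ {v} → v ∈ to ∷ zs → v ∈ to ∷ list
    incl (here p)  = here p
    incl (there p) = there (incl′ p)

  segment : ∀ S Y {w y xs} → Walk G w y xs → w ∈ S → y ∈ Y → Segment S Y (y ∷ xs)
  segment S Y w w∈ y∈ with segmentOrTail S Y w y∈
  ... | inj₁ sg = sg
  ... | inj₂ tl = ⊥-elim (Tail.avoidsS tl (start∈ (walk (Tail.isPath tl))) w∈)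

  -- Menger's two paths with both ends `a` and `b` of an initial path kept, though perhaps on
  -- different paths. They must be kept because in the application `a` and `b` are neighbours of the
  -- two ends of a long path.
  record Linkage (X Y : List (Fin n)) (a b : Fin n) : Set where
    field
      {s₁ s₂ e₂} : Fin n
      {L₁ L₂}    : List (Fin n)
      path₁      : Path G s₁ b L₁
      path₂      : Path G s₂ e₂ L₂
      disjoint   : ∀ {v} → v ∈ b ∷ L₁ → v ∈ e₂ ∷ L₂ → ⊥
      starts     : (s₁ ≡ a × s₂ ∈ X) ⊎ (s₂ ≡ a × s₁ ∈ X)
      end₂       : e₂ ∈ Y
      avoidsX₁   : ∀ {v} → v ∈ b ∷ L₁ → v ∈ X → v ≡ s₁
      avoidsX₂   : ∀ {v} → v ∈ e₂ ∷ L₂ → v ∈ X → v ≡ s₂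
      avoidsY₁   : ∀ {v} → v ∈ L₁ → v ∉ Y
      avoidsY₂   : ∀ {v} → v ∈ L₂ → v ∉ Y

  suffix : ∀ {x b e P} → Path G x b P → e ∈ b ∷ P → e ≢ x →
    ∃ λ Z → Path G e b Z × (∀ {v} → v ∈ Z → v ∈ P) × x ∉ b ∷ Z
  suffix {x} {b} (path w u) e∈ e≢x with split w e∈
  ... | ys , zs , refl , w₁ , w₂ = zs , path w₂ (cons-! (head-∉ u ∘ ∈-++⁺ʳ ys) (proj₁ (proj₂ uu))) , ∈-++⁺ʳ ys , x∉
    where
    uu = ++-!⁻ ys (tail-! u)
    x∈ys : x ∈ ys
    x∈ys = case start∈ w₁ of λ { (here refl) → ⊥-elim (e≢x refl) ; (there q) → q }
    x∉ : x ∉ b ∷ zs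
    x∉ (here refl) = head-∉ u (∈-++⁺ˡ x∈ys)
    x∉ (there q)   = proj₂ (proj₂ uu) x∈ys q

  shift-end : ∀ {b : Fin n} {x} P {Q} → Unique (b ∷ P ++ x ∷ Q) → Unique (x ∷ P)
  shift-end P {Q} u = cons-! (λ p → proj₂ (proj₂ (++-!⁻ P (tail-! u))) p (here refl)) (proj₁ (++-!⁻ P (tail-! u)))

  -- One step of the augmenting-path proof of Menger's theorem: P is cut at the last
  -- vertex x at which a walk avoiding b leaves it, and everything after x joins Y.
  linkage : NoCutVertex G → ∀ {X a a′} → a′ ∈ X → a′ ≢ a →
    ∀ fuel {P Y b b′} → length P < fuel → Path G a b P → a ∈ X → b ∈ Y → b′ ∈ Y → b′ ≢ b →
    (∀ {v} → v ∈ b ∷ P → v ∈ X → v ≡ a) → (∀ {v} → v ∈ P → v ∉ Y) → Linkage X Y a b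
  linkage conn {X} {a} {a′} a′∈ a′≢a (suc fuel) {P} {Y} {b} {b′} (s≤s len) (path p up) a∈ b∈ b′∈ b′≢b onlyX onlyY =
    augment (segment (X ++ P) Y (proj₁ (proj₂ avoid)) (∈-++⁺ˡ (proj₁ (proj₂ start))) b′∈)
    where
    -- The walk has to avoid `b`, so it cannot start there; if `a` is `b`, it starts at the second
    -- vertex of `X`.
    start : ∃ λ s → s ∈ X × s ≢ b
    start with a F.≟ b
    ... | yes refl = a′ , a′∈ , a′≢a
    ... | no  a≢b  = a , a∈ , a≢b
    avoid : ∃ λ xs → Walk G (proj₁ start) b′ xs × b ∉ b′ ∷ xs
    avoid = conn b (proj₁ start) b′ (proj₂ (proj₂ start)) b′≢b
    augment : Segment (X ++ P) Y (b′ ∷ proj₁ avoid) → Linkage X Y a b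
    augment sg with Segment.from sg ∈? P
    -- The segment starts in `X` off `P`, so `P` itself and the segment are the two paths.
    ... | no x∉P = record
      { path₁ = path p up
      ; path₂ = isPath
      ; disjoint = λ { (here refl) q → proj₂ (proj₂ avoid) (sub q)
                     ; (there v∈) q → [ (λ { refl → x∉P v∈ }) , (λ v∉ → v∉ (∈-++⁺ʳ X v∈)) ]′ (avoidsS q) }
      ; starts = inj₁ (refl , [ id , (λ q → ⊥-elim (x∉P q)) ]′ (∈-++⁻ X from∈))
      ; end₂ = to∈
      ; avoidsX₁ = onlyX
      ; avoidsX₂ = λ q vX → [ id , (λ v∉ → ⊥-elim (v∉ (∈-++⁺ˡ vX))) ]′ (avoidsS q)
      ; avoidsY₁ = onlyY
      ; avoidsY₂ = avoidsY }
      where open Segment sg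
    ... | yes x∈P with split p (there x∈P)
    ... | P₁ , .[] , refl , _ , nil = ⊥-elim (head-∉ up x∈P)
    -- Recursion on the part of `P` before `x`. The new target contains the rest of `P` and the
    -- segment, so the paths found there can meet these only at their ends.
    ... | P₁ , (x ∷ P₃) , refl , w₁ , w₂@(cons _ _) = finish (linkage conn a′∈ a′≢a fuel
            (<-≤-trans (subst (length P₁ <_) (sym (length-++ P₁)) (m<m+n (length P₁) (s≤s z≤n))) len)
            (path w₁ (shift-end P₁ up)) a∈ x∈Y′ b∈Y′ (λ { refl → head-∉ up x∈P })
            (λ { (here refl) → onlyX (there x∈P) ; (there q) → onlyX (there (∈-++⁺ˡ q)) })
            P₁∉Y′)
      where
      open Segment sg
      P₂ = x ∷ P₃
      Y′ = b ∷ P₂ ++ (list ++ Y)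
      x∈Y′ : x ∈ Y′
      x∈Y′ = there (here refl)
      b∈Y′ : b ∈ Y′
      b∈Y′ = here refl
      b≢x : b ≢ x
      b≢x refl = head-∉ up x∈P
      P₁P₂ : ∀ {v} → v ∈ P₁ → v ∈ P₂ → ⊥
      P₁P₂ = proj₂ (proj₂ (++-!⁻ P₁ (tail-! up)))
      P₂! : Unique P₂
      P₂! = proj₁ (proj₂ (++-!⁻ P₁ (tail-! up)))
      b∉P₂ : b ∉ P₂
      b∉P₂ q = head-∉ up (∈-++⁺ʳ P₁ q)
      segP : ∀ {v} → v ∈ to ∷ list → v ∈ P₁ ++ P₂ → v ≡ x
      segP q v∈ = [ id , (λ v∉ → ⊥-elim (v∉ (∈-++⁺ʳ X v∈))) ]′ (avoidsS q)
      P₁∉Y′ : ∀ {v} → v ∈ P₁ → v ∉ Y′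
      P₁∉Y′ q (here refl) = head-∉ up (∈-++⁺ˡ q)
      P₁∉Y′ q (there r) with ∈-++⁻ P₂ r
      ... | inj₁ r′ = P₁P₂ q r′
      ... | inj₂ r′ with ∈-++⁻ list r′
      ... | inj₁ z with segP (there z) (∈-++⁺ˡ q)
      ... | refl = P₁P₂ q (here refl)
      P₁∉Y′ q (there r) | inj₂ r′ | inj₂ z = onlyY (∈-++⁺ˡ q) z
      P₂∉X : ∀ {v} → v ∈ b ∷ P₃ → v ∉ X
      P₂∉X (here refl) vX with onlyX (here refl) vX
      ... | refl = case start∈ w₁ of λ { (here r) → b≢x r ; (there r) → head-∉ up (∈-++⁺ˡ r) }
      P₂∉X (there q) vX with onlyX (there (∈-++⁺ʳ P₁ (there q))) vX
      ... | refl = case start∈ w₁ of λ { (here refl) → head-∉ P₂! q ; (there r) → P₁P₂ r (there q) }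
      x∉seg-end : ∀ {v} → v ∈ to ∷ list → v ∈ X → v ≡ x
      x∉seg-end q vX = [ id , (λ v∉ → ⊥-elim (v∉ (∈-++⁺ˡ vX))) ]′ (avoidsS q)
      b∉seg : b ∉ to ∷ list
      b∉seg q = proj₂ (proj₂ avoid) (sub q)
      P₂⊆Y′ : ∀ {v} → v ∈ b ∷ P₂ → v ∈ Y′
      P₂⊆Y′ (here p)  = here p
      P₂⊆Y′ (there p) = there (∈-++⁺ˡ p)
      Y⊆Y′ : ∀ {v} → v ∈ Y → v ∈ Y′
      Y⊆Y′ p = there (∈-++⁺ʳ P₂ (∈-++⁺ʳ list p))
      list⊆Y′ : ∀ {v} → v ∈ list → v ∈ Y′
      list⊆Y′ p = there (∈-++⁺ʳ P₂ (∈-++⁺ˡ p))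
      seg⊆Y′ : ∀ {v} → v ∈ to ∷ list → v ∈ Y′
      seg⊆Y′ (here refl) = Y⊆Y′ to∈
      seg⊆Y′ (there p) = list⊆Y′ p
      finish : Linkage X Y′ a x → Linkage X Y a b
      finish l = byEnd
        where
        open Linkage l
        e₂≢x : e₂ ≢ x
        e₂≢x refl = disjoint (here refl) (here refl)
        -- The second path has reached `P` beyond `x` and follows it to `b`; the first, which ends
        -- at `x`, takes the segment into `Y`. The two paths change roles.
        endOnP : e₂ ∈ b ∷ P₂ → Linkage X Y a b
        endOnP e∈ with suffix (path w₂ (cons-! b∉P₂ P₂!)) e∈ e₂≢x
        ... | Z , path z uz , Z⊆ , x∉Z = record
          { path₁ = path (walk path₂ ++ʷ z) (cons-! b∉ (++-! (tail-! (unique path₂)) (tail-! uz)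
                      λ p q → avoidsY₂ p (P₂⊆Y′ (there (Z⊆ q)))))
          ; path₂ = path (walk path₁ ++ʷ walk isPath) (cons-! to∉ (++-! (tail-! (unique path₁)) (tail-! (unique isPath))
                      λ p q → avoidsY₁ p (list⊆Y′ q)))
          ; disjoint = dis
          ; starts = [ inj₂ , inj₁ ]′ starts
          ; end₂ = to∈
          ; avoidsX₁ = λ { (here refl) vX → ⊥-elim (P₂∉X (here refl) vX)
                         ; (there p) vX → [ (λ q → avoidsX₂ (there q) vX) , (λ q → ⊥-elim (P₂∉X (there (Z⊆P₃ q)) vX)) ]′ (∈-++⁻ L₂ p) }
          ; avoidsX₂ = λ p vX → [ (λ q → avoidsX₁ (there q) vX) , (λ q → segX q vX) ]′ (fromEnd p)
          ; avoidsY₁ = λ p vY → [ (λ q → avoidsY₂ q (Y⊆Y′ vY)) , (λ q → onlyY (∈-++⁺ʳ P₁ (Z⊆ q)) vY) ]′ (∈-++⁻ L₂ p)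
          ; avoidsY₂ = λ p vY → [ (λ q → avoidsY₁ q (Y⊆Y′ vY)) , (λ q → avoidsY q vY) ]′ (∈-++⁻ L₁ p) }
          where
          Z⊆P₃ : ∀ {v} → v ∈ Z → v ∈ P₃
          Z⊆P₃ q with Z⊆ q
          ... | here refl = ⊥-elim (x∉Z (there q))
          ... | there r   = r
          b∉ : b ∉ L₂ ++ Z
          b∉ p = [ (λ q → avoidsY₂ q b∈Y′) , head-∉ uz ]′ (∈-++⁻ L₂ p)
          to∉ : to ∉ L₁ ++ list
          to∉ p = [ (λ q → avoidsY₁ q (seg⊆Y′ (here refl))) , head-∉ (unique isPath) ]′ (∈-++⁻ L₁ p)
          fromEnd : ∀ {v} → v ∈ to ∷ L₁ ++ list → v ∈ L₁ ⊎ v ∈ to ∷ list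
          fromEnd (here p)  = inj₂ (here p)
          fromEnd (there p) = [ inj₁ , inj₂ ∘ there ]′ (∈-++⁻ L₁ p)
          segX : ∀ {v} → v ∈ to ∷ list → v ∈ X → v ≡ s₁
          segX q vX with x∉seg-end q vX
          ... | refl = avoidsX₁ (here refl) vX
          fromEnd′ : ∀ {v} → v ∈ b ∷ L₂ ++ Z → v ∈ L₂ ⊎ v ∈ b ∷ Z
          fromEnd′ (here p)  = inj₂ (here p)
          fromEnd′ (there p) = [ inj₁ , inj₂ ∘ there ]′ (∈-++⁻ L₂ p)
          bZ⊆ : ∀ {v} → v ∈ b ∷ Z → v ∈ b ∷ P₂
          bZ⊆ (here p)  = here p
          bZ⊆ (there p) = there (Z⊆ p)
          dis : ∀ {v} → v ∈ b ∷ L₂ ++ Z → v ∈ to ∷ L₁ ++ list → ⊥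
          dis p q with fromEnd′ p | fromEnd q
          ... | inj₁ p′ | inj₁ q′ = disjoint (there q′) (there p′)
          ... | inj₁ p′ | inj₂ q′ = avoidsY₂ p′ (seg⊆Y′ q′)
          ... | inj₂ p′ | inj₁ q′ = avoidsY₁ q′ (P₂⊆Y′ (bZ⊆ p′))
          ... | inj₂ (here refl) | inj₂ q′ = b∉seg q′
          ... | inj₂ (there p′)  | inj₂ q′ with segP q′ (∈-++⁺ʳ P₁ (Z⊆ p′))
          ... | refl = x∉Z (there p′)
        -- The second path has reached `Y` or the segment, which leaves the rest of `P` from `x` to
        -- `b` to the first path.
        endOff : ∀ {t Z} → Path G e₂ t Z → t ∈ Y → (∀ {v} → v ∈ Z → v ∈ list) →
          (∀ {v} → v ∈ t ∷ Z → v ∉ b ∷ P₂) → (∀ {v} → v ∈ t ∷ Z → v ∈ X → v ≡ s₂) → Linkage X Y a b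
        endOff {t} {Z} (path z uz) t∈ Z⊆ Z∉ ZX = record
          { path₁ = path (walk path₁ ++ʷ w₂) (cons-! b∉ (++-! (tail-! (unique path₁)) P₂!
                      λ p q → avoidsY₁ p (P₂⊆Y′ (there q))))
          ; path₂ = path (walk path₂ ++ʷ z) (cons-! t∉ (++-! (tail-! (unique path₂)) (tail-! uz)
                      λ p q → avoidsY₂ p (list⊆Y′ (Z⊆ q))))
          ; disjoint = dis
          ; starts = starts
          ; end₂ = t∈
          ; avoidsX₁ = λ p vX → [ (λ q → avoidsX₁ (there q) vX) , (λ q → P₂X q vX) ]′ (fromEnd p)
          ; avoidsX₂ = λ p vX → [ (λ q → avoidsX₂ (there q) vX) , (λ q → ZX q vX) ]′ (fromEnd′ p)
          ; avoidsY₁ = λ p vY → [ (λ q → avoidsY₁ q (Y⊆Y′ vY)) , (λ q → onlyY (∈-++⁺ʳ P₁ q) vY) ]′ (∈-++⁻ L₁ p)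
          ; avoidsY₂ = λ p vY → [ (λ q → avoidsY₂ q (Y⊆Y′ vY)) , (λ q → avoidsY (Z⊆ q) vY) ]′ (∈-++⁻ L₂ p) }
          where
          b∉ : b ∉ L₁ ++ P₂
          b∉ p = [ (λ q → avoidsY₁ q b∈Y′) , b∉P₂ ]′ (∈-++⁻ L₁ p)
          t∉ : t ∉ L₂ ++ Z
          t∉ p = [ (λ q → avoidsY₂ q (Y⊆Y′ t∈)) , head-∉ uz ]′ (∈-++⁻ L₂ p)
          fromEnd : ∀ {v} → v ∈ b ∷ L₁ ++ P₂ → v ∈ L₁ ⊎ v ∈ b ∷ P₂
          fromEnd (here p)  = inj₂ (here p)
          fromEnd (there p) = [ inj₁ , inj₂ ∘ there ]′ (∈-++⁻ L₁ p)
          fromEnd′ : ∀ {v} → v ∈ t ∷ L₂ ++ Z → v ∈ L₂ ⊎ v ∈ t ∷ Z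
          fromEnd′ (here p)  = inj₂ (here p)
          fromEnd′ (there p) = [ inj₁ , inj₂ ∘ there ]′ (∈-++⁻ L₂ p)
          P₂X : ∀ {v} → v ∈ b ∷ P₂ → v ∈ X → v ≡ s₁
          P₂X (here refl) vX = ⊥-elim (P₂∉X (here refl) vX)
          P₂X (there (here refl)) vX = avoidsX₁ (here refl) vX
          P₂X (there (there q)) vX = ⊥-elim (P₂∉X (there q) vX)
          ZY′ : ∀ {v} → v ∈ t ∷ Z → v ∈ Y′
          ZY′ (here refl) = Y⊆Y′ t∈
          ZY′ (there q)   = list⊆Y′ (Z⊆ q)
          dis : ∀ {v} → v ∈ b ∷ L₁ ++ P₂ → v ∈ t ∷ L₂ ++ Z → ⊥
          dis p q with fromEnd p | fromEnd′ q
          ... | inj₁ p′ | inj₁ q′ = disjoint (there p′) (there q′)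
          ... | inj₁ p′ | inj₂ q′ = avoidsY₁ p′ (ZY′ q′)
          ... | inj₂ p′ | inj₁ q′ = avoidsY₂ q′ (P₂⊆Y′ p′)
          ... | inj₂ p′ | inj₂ q′ = Z∉ q′ p′
        byEnd : Linkage X Y a b
        byEnd with e₂ ∈? (b ∷ P₂)
        ... | yes e∈ = endOnP e∈
        ... | no  e∉ with end₂
        ... | here p = ⊥-elim (e∉ (here p))
        ... | there p with ∈-++⁻ P₂ p
        ... | inj₁ q = ⊥-elim (e∉ (there q))
        ... | inj₂ q with ∈-++⁻ list q
        ... | inj₂ r = endOff (path nil ([] ∷ [])) r (λ ()) (λ { (here refl) → e∉ }) (λ { (here refl) → avoidsX₂ (here refl) })
        ... | inj₁ r with suffix isPath (there r) e₂≢x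
        ... | Z , z , Z⊆ , x∉Z = endOff z to∈ Z⊆
          (λ { v∈ (here refl) → b∉seg (incl v∈) ; v∈ (there v∈P₂) → notx v∈ (segP (incl v∈) (∈-++⁺ʳ P₁ v∈P₂)) })
          (λ v∈ vX → ⊥-elim (notx v∈ (x∉seg-end (incl v∈) vX)))
          where
          incl : ∀ {v} → v ∈ to ∷ Z → v ∈ to ∷ list
          incl (here p)  = here p
          incl (there p) = there (Z⊆ p)
          notx : ∀ {v} → v ∈ to ∷ Z → v ≢ x
          notx v∈ refl = x∉Z v∈

-- Kopylov's lemma

module Kopylov {n : ℕ} (G : Graph n) (G-sym : ∀ u v → G u v ≡ G v u) (G-irrefl : ∀ v → G v v ≡ false) where

  open CMSolver (++-commutativeMonoid {A = Fin n}) using (solve; _⊕_; _⊜_)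

  sym-true : ∀ {u v} → G u v ≡ true → G v u ≡ true
  sym-true {u} {v} e = trans (G-sym v u) e

  first : (p : Fin n → Bool) → ∀ {w z ys} → Walk G w z ys →
    (∀ {v} → v ∈ ys → p v ≡ false) ⊎
    (∃ λ q → ∃₂ λ gap zs → ys ≡ gap ++ zs × Walk G w q gap × Walk G q z zs × q ∈ zs × p q ≡ true ×
      (∀ {v} → v ∈ gap → p v ≡ false))
  first p nil = inj₁ λ ()
  first p {w} (cons e r) with p w in eq
  ... | true = inj₂ (w , [] , _ , refl , nil , cons e r , here refl , eq , λ ())
  ... | false with first p r
  ... | inj₁ none = inj₁ λ { (here refl) → eq ; (there q) → none q }
  ... | inj₂ (q , gap , zs , refl , w₁ , w₂ , q∈ , pq , none) =
    inj₂ (q , w ∷ gap , zs , refl , cons e w₁ , w₂ , q∈ , pq , λ { (here refl) → eq ; (there m) → none m })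

  firstOrEnd : (p : Fin n → Bool) → ∀ {w z ys} → Walk G w z ys → p z ≡ true →
    ∃ λ q → ∃₂ λ gap zs → ys ≡ gap ++ zs × Walk G w q gap × Walk G q z zs × p q ≡ true ×
      (∀ {v} → v ∈ gap → p v ≡ false)
  firstOrEnd p {z = z} {ys} w pz with first p w
  ... | inj₁ none = z , ys , [] , sym (++-identityʳ ys) , w , nil , pz , none
  ... | inj₂ (q , gap , zs , eq , w₁ , w₂ , _ , pq , none) = q , gap , zs , eq , w₁ , w₂ , pq , none

  last : (p : Fin n → Bool) → ∀ {w z ys} → Walk G w z ys →
    (∀ {v} → v ∈ ys → p v ≡ false) ⊎
    (∃₂ λ q s → ∃₂ λ xs zs → ys ≡ xs ++ q ∷ zs × Walk G w q xs × G q s ≡ true × Walk G s z zs × p q ≡ true ×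
      (∀ {v} → v ∈ zs → p v ≡ false))
  last p nil = inj₁ λ ()
  last p {w} (cons e r) with last p r
  ... | inj₂ (q , s , xs , zs , refl , w₁ , e′ , w₂ , pq , none) =
    inj₂ (q , s , w ∷ xs , zs , refl , cons e w₁ , e′ , w₂ , pq , none)
  ... | inj₁ none with p w in eq
  ... | true  = inj₂ (w , _ , [] , _ , refl , nil , e , r , eq , none)
  ... | false = inj₁ λ { (here refl) → eq ; (there q) → none q }

  penultimate : ∀ {w z y ys} → Walk G w z (y ∷ ys) → ∃ λ t → t ∈ y ∷ ys × G t z ≡ true
  penultimate (cons e nil) = _ , here refl , e
  penultimate (cons e w@(cons _ _)) with penultimate w
  ... | t , t∈ , e′ = t , there t∈ , e′

  -- From z back to the first neighbour q of x beyond p, over the edge qx, then along the path to p.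
  fan : ∀ {x z p xs} → Path G x z xs → G x z ≡ true → p ∈ z ∷ xs → p ≢ z →
    ∃ λ C → Walk G z p C × Unique (p ∷ C) × (∀ {v} → v ∈ p ∷ C → v ∈ z ∷ xs) ×
      count (G x) (z ∷ xs) ≤ length C
  fan {x} {z} {p} (path w u) xz p∈ p≢z with split w p∈
  ... | X₁ , .[] , refl , w₁ , nil = ⊥-elim (p≢z refl)
  ... | X₁ , .(p ∷ _) , refl , w₁ , cons e w₂ with firstOrEnd (G x) w₂ xz
  ... | q , gap , X₃ , refl , _ , w₃ , xq , none with reverseʷ G-sym w₃
  ... | R , r , R↭ = R ++ q ∷ X₁ , r ++ʷ cons (sym-true xq) w₁ , C! , C⊆ , bound
    where
    open ≤-Reasoning
    -- The only vertices of the path left out are those of `gap`, none of them adjacent to `x`.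
    perm : gap ++ (p ∷ R ++ q ∷ X₁) ↭ z ∷ X₁ ++ p ∷ gap ++ X₃
    perm = ↭-trans
      (solve 5 (λ g p r q x → g ⊕ (p ⊕ (r ⊕ (q ⊕ x))) ⊜ (q ⊕ r) ⊕ (x ⊕ (p ⊕ g))) ↭-refl gap (p ∷ []) R (q ∷ []) X₁)
      (↭-trans (++⁺ʳ _ R↭)
      (solve 5 (λ g p x₃ z x → (z ⊕ x₃) ⊕ (x ⊕ (p ⊕ g)) ⊜ z ⊕ (x ⊕ (p ⊕ (g ⊕ x₃)))) ↭-refl gap (p ∷ []) X₃ (z ∷ []) X₁))
    C! : Unique (p ∷ R ++ q ∷ X₁)
    C! = proj₁ (proj₂ (++-!⁻ gap (Unique-↭ (↭-sym perm) u)))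
    C⊆ : ∀ {v} → v ∈ p ∷ R ++ q ∷ X₁ → v ∈ z ∷ X₁ ++ p ∷ gap ++ X₃
    C⊆ v∈ = ∈-resp-↭ perm (∈-++⁺ʳ gap v∈)
    -- `x` itself lies on this part and is not its own neighbour, which makes up for `p` missing
    -- from the list of the walk.
    headCount : ∀ {p X₁} → Walk G x p X₁ → count (G x) (p ∷ X₁) ≤ length X₁
    headCount nil = ≤-reflexive (count-false (G x) [] (G-irrefl x))
    headCount {p} (cons {xs = l} e _) = ≤-trans (count-∷≤ (G x) p (x ∷ l))
      (s≤s (≤-trans (≤-reflexive (count-false (G x) l (G-irrefl x))) (count≤length (G x) l)))
    bound : count (G x) (z ∷ X₁ ++ p ∷ gap ++ X₃) ≤ length (R ++ q ∷ X₁)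
    bound = begin
      count (G x) (z ∷ X₁ ++ p ∷ gap ++ X₃)  ≡⟨ sym (count-↭ (G x) perm) ⟩
      count (G x) (gap ++ (p ∷ R ++ q ∷ X₁)) ≡⟨ count-++ (G x) gap _ ⟩
      count (G x) gap + _                    ≡⟨ cong (_+ count (G x) (p ∷ R ++ q ∷ X₁)) (count-none (G x) gap none) ⟩
      count (G x) (p ∷ R ++ q ∷ X₁)          ≡⟨ count-↭ (G x) (solve 4 (λ p r q x → p ⊕ (r ⊕ (q ⊕ x)) ⊜ (q ⊕ r) ⊕ (p ⊕ x)) ↭-refl (p ∷ []) R (q ∷ []) X₁) ⟩
      count (G x) ((q ∷ R) ++ p ∷ X₁)        ≡⟨ count-++ (G x) (q ∷ R) _ ⟩
      count (G x) (q ∷ R) + count (G x) (p ∷ X₁) ≤⟨ +-mono-≤ (count≤length (G x) (q ∷ R)) (headCount w₁) ⟩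
      suc (length R) + length X₁             ≡⟨ sym (+-suc (length R) (length X₁)) ⟩
      length R + suc (length X₁)             ≡⟨ sym (length-++ R) ⟩
      length (R ++ q ∷ X₁)                   ∎

  module _ {c : ℕ} (conn : NoCutVertex G) (noCycle : NoCycleAbove G c) where

    -- The case in which no neighbour of `y` on the path precedes a neighbour of `x`. Two disjoint
    -- paths join the stretches containing these neighbours, with `a` and `b` among their ends, so
    -- that a fan on each side closes a cycle whose length is at least the sum of the two counts.
    uncrossed : ∀ {x a xs M b y ys} → Path G x a xs → G x a ≡ true → Path G a b M →
      Path G y b ys → G y b ≡ true →
      (∀ {v} → v ∈ b ∷ M → v ∈ a ∷ xs → v ≡ a) → (∀ {v} → v ∈ M → v ∉ b ∷ ys) →
      (∀ {v} → v ∈ a ∷ xs → v ∈ b ∷ ys → v ≡ b) →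
      count (G x) (a ∷ xs) + count (G y) (b ∷ ys) ≤ c
    uncrossed {x} {a} {xs} {M} {b} {y} {ys} pX xa pM pY yb onlyX onlyY XY =
      close (linkage G conn (start∈ (walk pX)) (adj≢ xa) (suc (length M)) ≤-refl pM (here refl) (here refl)
        (start∈ (walk pY)) (adj≢ yb) onlyX onlyY)
      where
      adj≢ : ∀ {u v} → G u v ≡ true → u ≢ v
      adj≢ {u} e refl = false≢true (G-irrefl u) e
      close : Linkage G (a ∷ xs) (b ∷ ys) a b → count (G x) (a ∷ xs) + count (G y) (b ∷ ys) ≤ c
      close l = finish cx (fan pY yb end₂ (λ { refl → disjoint (here refl) (here refl) })) (reverseʷ G-sym (walk path₂))
        where
        open Linkage l
        s₁≢s₂ : s₁ ≢ s₂
        s₁≢s₂ refl = disjoint (start∈ (walk path₁)) (start∈ (walk path₂))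
        -- The fan starts at `a`, which may begin either linking path; it is reversed where
        -- necessary, so as to lead from `s₂` to `s₁`.
        cx : ∃ λ C → Walk G s₂ s₁ C × Unique (s₁ ∷ C) × (∀ {v} → v ∈ s₁ ∷ C → v ∈ a ∷ xs) ×
          count (G x) (a ∷ xs) ≤ length C
        cx with starts
        ... | inj₂ (refl , s₁∈) = fan pX xa s₁∈ s₁≢s₂
        ... | inj₁ (refl , s₂∈) with fan pX xa s₂∈ (s₁≢s₂ ∘ sym)
        ... | C , w , u , sub , le with reverseʷ G-sym w
        ... | C′ , w′ , p = C′ , w′ , Unique-↭ (↭-sym p) u , (λ v∈ → sub (∈-resp-↭ p v∈)) ,
          ≤-trans le (≤-reflexive (suc-injective (sym (↭-length p))))
        finish : (∃ λ C → Walk G s₂ s₁ C × Unique (s₁ ∷ C) × (∀ {v} → v ∈ s₁ ∷ C → v ∈ a ∷ xs) ×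
            count (G x) (a ∷ xs) ≤ length C) →
          (∃ λ D → Walk G b e₂ D × Unique (e₂ ∷ D) × (∀ {v} → v ∈ e₂ ∷ D → v ∈ b ∷ ys) ×
            count (G y) (b ∷ ys) ≤ length D) →
          (∃ λ R → Walk G e₂ s₂ R × s₂ ∷ R ↭ e₂ ∷ L₂) →
          count (G x) (a ∷ xs) + count (G y) (b ∷ ys) ≤ c
        finish (C , wC , uC , C⊆ , leC) (D , wD , uD , D⊆ , leD) (R , wR , R↭) =
          ≤-trans (≤-trans (+-mono-≤ leC leD) lengths) (≮⇒≥ (noCycle s₂ (C ++ L₁ ++ D ++ R)
            (wC ++ʷ walk path₁ ++ʷ wD ++ʷ wR) cycle!))
          where
          open ≤-Reasoning
          R! : Unique (s₂ ∷ R)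
          R! = Unique-↭ (↭-sym R↭) (unique path₂)
          R⊆ : ∀ {v} → v ∈ R → v ∈ e₂ ∷ L₂
          R⊆ q = ∈-resp-↭ R↭ (there q)
          DR : ∀ {v} → v ∈ D → v ∈ R → ⊥
          DR d r with R⊆ r
          ... | here refl = head-∉ uD d
          ... | there q   = avoidsY₂ q (D⊆ (there d))
          L₁DR : ∀ {v} → v ∈ L₁ → v ∈ D ++ R → ⊥
          L₁DR q m = [ (λ d → avoidsY₁ q (D⊆ (there d))) , (λ r → disjoint (there q) (R⊆ r)) ]′ (∈-++⁻ D m)
          CD : ∀ {v} → v ∈ C → v ∈ D → ⊥
          CD p d with XY (C⊆ (there p)) (D⊆ (there d))
          ... | refl with avoidsX₁ (here refl) (C⊆ (there p))
          ... | refl = head-∉ uC p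
          CR : ∀ {v} → v ∈ C → v ∈ R → ⊥
          CR p r with avoidsX₂ (R⊆ r) (C⊆ (there p))
          ... | refl = head-∉ R! r
          CL₁ : ∀ {v} → v ∈ C → v ∈ L₁ → ⊥
          CL₁ p q with avoidsX₁ (there q) (C⊆ (there p))
          ... | refl = head-∉ uC p
          CLDR : ∀ {v} → v ∈ C → v ∈ L₁ ++ D ++ R → ⊥
          CLDR p m = [ CL₁ p , (λ m′ → [ CD p , CR p ]′ (∈-++⁻ D m′)) ]′ (∈-++⁻ L₁ m)
          cycle! : Unique (C ++ L₁ ++ D ++ R)
          cycle! = ++-! (tail-! uC) (++-! (tail-! (unique path₁)) (++-! (tail-! uD) (tail-! R!) DR) L₁DR) CLDR
          lengths : length C + length D ≤ length (C ++ L₁ ++ D ++ R)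
          lengths = begin
            length C + length D                               ≤⟨ m≤m+n _ (length L₁ + length R) ⟩
            (length C + length D) + (length L₁ + length R)    ≡⟨ arith (length C) (length D) (length L₁) (length R) ⟩
            length C + (length L₁ + (length D + length R))    ≡⟨ cong (λ k → length C + (length L₁ + k)) (sym (length-++ D)) ⟩
            length C + (length L₁ + length (D ++ R))          ≡⟨ cong (length C +_) (sym (length-++ L₁)) ⟩
            length C + length (L₁ ++ D ++ R)                  ≡⟨ sym (length-++ C) ⟩
            length (C ++ L₁ ++ D ++ R)                        ∎
            where
            arith : ∀ a b c d → (a + b) + (c + d) ≡ a + (c + (b + d))
            arith = solve-∀

    -- From `x` to `u`, over to `y`, back along the path to `v` and home to `x`: this cycle misses
    -- only `g`.
    crossed : ∀ {x y u v P g Q} → Walk G x u P → Walk G v y Q → Unique (y ∷ P ++ u ∷ g ++ Q) →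
      G y u ≡ true → G x v ≡ true → suc (length P) + suc (length Q) ≤ c
    crossed {x} {y} {u} {v} {P} {g} {Q} wP wQ u! yu xv with reverseʷ G-sym wQ
    ... | R , r , R↭ = ≤-trans (≤-reflexive len) (≮⇒≥ (noCycle x (P ++ u ∷ R ++ v ∷ [])
            (wP ++ʷ cons (sym-true yu) (r ++ʷ cons (sym-true xv) nil)) cycle!))
      where
      cycle↭ : P ++ u ∷ R ++ v ∷ [] ↭ P ++ u ∷ y ∷ Q
      cycle↭ = ++⁺ˡ P (prep u (↭-trans (++-comm R (v ∷ [])) R↭))
      cycle! : Unique (P ++ u ∷ R ++ v ∷ [])
      cycle! = Unique-↭ (↭-sym cycle↭) (proj₁ (proj₂ (++-!⁻ g (Unique-↭
        (solve 5 (λ y p u g q → y ⊕ (p ⊕ (u ⊕ (g ⊕ q))) ⊜ g ⊕ (p ⊕ (u ⊕ (y ⊕ q)))) ↭-refl (y ∷ []) P (u ∷ []) g Q) u!))))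
      len : suc (length P) + suc (length Q) ≡ length (P ++ u ∷ R ++ v ∷ [])
      len = trans (sym (+-suc (length P) _)) (trans (sym (length-++ P)) (↭-length (↭-sym cycle↭)))

    -- With an empty gap the cycle of `crossed` would pass through all vertices of the path, more
    -- than `c` of them.
    notConsecutive : ∀ {x y u v P Q} → Walk G x u P → Walk G v y Q → Unique (y ∷ P ++ u ∷ Q) →
      c ≤ length (P ++ u ∷ Q) → G y u ≡ true → G x v ≡ true → ⊥
    notConsecutive {u = u} {P = P} {Q} wP wQ u! len yu xv = 1+n≰n (begin
      suc (suc (length P + length Q)) ≡⟨ cong suc (sym (+-suc (length P) (length Q))) ⟩
      suc (length P) + suc (length Q) ≤⟨ crossed {g = []} wP wQ u! yu xv ⟩
      c                               ≤⟨ len ⟩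
      length (P ++ u ∷ Q)             ≡⟨ length-++ P ⟩
      length P + suc (length Q)       ≡⟨ +-suc (length P) (length Q) ⟩
      suc (length P + length Q)       ∎)
      where open ≤-Reasoning

    bit : Bool → ℕ
    bit b = if b then 1 else 0

    -- Each edge of the walk is charged with `B` at its first end and `A` at its second, and at most
    -- one of these holds. Only `A` at the start of the walk is left over.
    alternating : ∀ (A B : Fin n → Bool) {a z l} → Walk G a z l →
      (∀ {l₁ u v l₂} → l ≡ l₁ ++ u ∷ l₂ → Walk G a u l₁ → Walk G v z l₂ → B u ≡ true → A v ≡ true → ⊥) →
      count A (l ++ z ∷ []) + count B l ≤ length l + bit (A a)
    alternating A B {z = z} nil h = ≤-reflexive (trans (+-identityʳ _) (+-identityʳ _))
    alternating A B {a} {z} (cons {w = w} {xs = l} e r) h = begin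
      (bit (A a) + count A (l ++ z ∷ [])) + (bit (B a) + count B l) ≡⟨ arith (bit (A a)) _ (bit (B a)) _ ⟩
      (count A (l ++ z ∷ []) + count B l) + (bit (B a) + bit (A a)) ≤⟨ +-monoˡ-≤ _ (alternating A B r λ { refl w₁ w₂ → h refl (cons e w₁) w₂ }) ⟩
      (length l + bit (A w)) + (bit (B a) + bit (A a))              ≡⟨ arith′ (length l) (bit (A w)) _ _ ⟩
      length l + (bit (B a) + bit (A w)) + bit (A a)                ≤⟨ +-monoˡ-≤ _ (+-monoʳ-≤ (length l) (atMostOne (h refl nil r))) ⟩
      length l + 1 + bit (A a)                                      ≡⟨ cong (_+ bit (A a)) (+-comm (length l) 1) ⟩
      suc (length l) + bit (A a)                                    ∎
      where
      open ≤-Reasoning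
      arith : ∀ a b c d → (a + b) + (c + d) ≡ (b + d) + (c + a)
      arith = solve-∀
      arith′ : ∀ a b c d → (a + b) + (c + d) ≡ a + (c + b) + d
      arith′ = solve-∀
      atMostOne : ∀ {b d} → (b ≡ true → d ≡ true → ⊥) → bit b + bit d ≤ 1
      atMostOne {false} {false} _ = z≤n
      atMostOne {false} {true}  _ = s≤s z≤n
      atMostOne {true}  {false} _ = s≤s z≤n
      atMostOne {true}  {true}  h = ⊥-elim (h refl refl)

    -- The vertices of `g` contribute nothing, `alternating` bounds the stretches before and after
    -- by the lengths of `P` and `Q`, and `yu` and `xv` add one each: together exactly the length of
    -- the cycle that skips `g`.
    minimalCrossing : ∀ {x y u s v P g Q} → Walk G x u P → G u s ≡ true → Walk G s v g → Walk G v y Q →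
      Unique (y ∷ P ++ u ∷ g ++ Q) → c ≤ length (P ++ u ∷ g ++ Q) → G y u ≡ true → G x v ≡ true →
      (∀ {w} → w ∈ g → G x w ≡ false) → (∀ {w} → w ∈ g → G y w ≡ false) →
      count (G x) (y ∷ P ++ u ∷ g ++ Q) + count (G y) (y ∷ P ++ u ∷ g ++ Q) ≤ c
    minimalCrossing {x} {y} {u} {s} {v} {P} {g} {Q} wP us wg wQ u! len yu xv gA gB = begin
      count (G x) (y ∷ P ++ u ∷ g ++ Q) + count (G y) (y ∷ P ++ u ∷ g ++ Q)
        ≡⟨ cong₂ _+_ (total (G x) gA) (total (G y) gB) ⟩
      (count (G x) (P ++ u ∷ []) + count (G x) (Q ++ y ∷ [])) + (count (G y) (P ++ u ∷ []) + count (G y) (Q ++ y ∷ []))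
        ≡⟨ cong ((count (G x) (P ++ u ∷ []) + count (G x) (Q ++ y ∷ [])) +_) (cong₂ _+_ (trans (count-++ (G y) P (u ∷ [])) (cong (count (G y) P +_) (count-true (G y) [] yu)))
                                   (trans (count-++ (G y) Q (y ∷ [])) (trans (cong (count (G y) Q +_) (count-false (G y) [] (G-irrefl y))) (+-identityʳ _)))) ⟩
      (count (G x) (P ++ u ∷ []) + count (G x) (Q ++ y ∷ [])) + ((count (G y) P + 1) + count (G y) Q)
        ≡⟨ arith (count (G x) (P ++ u ∷ [])) _ _ _ ⟩
      ((count (G x) (P ++ u ∷ []) + count (G y) P) + 1) + (count (G x) (Q ++ y ∷ []) + count (G y) Q)
        ≤⟨ +-mono-≤ (+-monoˡ-≤ 1 (alternating (G x) (G y) wP left)) (alternating (G x) (G y) wQ right) ⟩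
      ((length P + bit (G x x)) + 1) + (length Q + bit (G x v))
        ≡⟨ cong₂ (λ b b′ → ((length P + bit b) + 1) + (length Q + bit b′)) (G-irrefl x) xv ⟩
      ((length P + 0) + 1) + (length Q + 1)
        ≡⟨ arith′ (length P) (length Q) ⟩
      suc (length P) + suc (length Q)
        ≤⟨ crossed {g = g} wP wQ u! yu xv ⟩
      c ∎
      where
      open ≤-Reasoning
      arith : ∀ a b c d → (a + b) + ((c + 1) + d) ≡ ((a + c) + 1) + (b + d)
      arith = solve-∀
      arith′ : ∀ p q → ((p + 0) + 1) + (q + 1) ≡ suc p + suc q
      arith′ = solve-∀
      total : (p : Fin n → Bool) → (∀ {w} → w ∈ g → p w ≡ false) →
        count p (y ∷ P ++ u ∷ g ++ Q) ≡ count p (P ++ u ∷ []) + count p (Q ++ y ∷ [])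
      total p none = trans (count-↭ p (solve 5 (λ y p u g q → y ⊕ (p ⊕ (u ⊕ (g ⊕ q))) ⊜ g ⊕ ((p ⊕ u) ⊕ (q ⊕ y))) ↭-refl (y ∷ []) P (u ∷ []) g Q))
        (trans (count-++ p g _) (trans (cong (_+ count p ((P ++ u ∷ []) ++ Q ++ y ∷ [])) (count-none p g none)) (count-++ p (P ++ u ∷ []) _)))
      left : ∀ {l₁ u′ v′ l₂} → P ≡ l₁ ++ u′ ∷ l₂ → Walk G x u′ l₁ → Walk G v′ u l₂ → G y u′ ≡ true → G x v′ ≡ true → ⊥
      left {l₁} {u′} {v′} {l₂} refl w₁ w₂ = notConsecutive w₁ (w₂ ++ʷ cons us (wg ++ʷ wQ))
        (subst (λ l → Unique (y ∷ l)) assoc u!) (subst (λ l → c ≤ length l) assoc len)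
        where
        assoc : (l₁ ++ u′ ∷ l₂) ++ u ∷ g ++ Q ≡ l₁ ++ u′ ∷ l₂ ++ u ∷ g ++ Q
        assoc = ++-assoc l₁ (u′ ∷ l₂) _
      right : ∀ {l₁ u′ v′ l₂} → Q ≡ l₁ ++ u′ ∷ l₂ → Walk G v u′ l₁ → Walk G v′ y l₂ → G y u′ ≡ true → G x v′ ≡ true → ⊥
      right {l₁} {u′} {v′} {l₂} refl w₁ w₂ = notConsecutive (wP ++ʷ cons us (wg ++ʷ w₁)) w₂
        (subst (λ l → Unique (y ∷ l)) assoc u!) (subst (λ l → c ≤ length l) assoc len)
        where
        assoc : P ++ u ∷ g ++ l₁ ++ u′ ∷ l₂ ≡ (P ++ u ∷ g ++ l₁) ++ u′ ∷ l₂
        assoc = sym (trans (++-assoc P (u ∷ g ++ l₁) _) (cong (λ l → P ++ u ∷ l) (++-assoc g l₁ _)))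

    -- Every crossing contains a minimal one: take the first neighbour `v′` of `x` after `u`, then
    -- the last neighbour `u′` of `y` before `v′`.
    crossing : ∀ {x y u s v P g Q} → Walk G x u P → G u s ≡ true → Walk G s v g → Walk G v y Q →
      Unique (y ∷ P ++ u ∷ g ++ Q) → c ≤ length (P ++ u ∷ g ++ Q) → G y u ≡ true → G x v ≡ true →
      count (G x) (y ∷ P ++ u ∷ g ++ Q) + count (G y) (y ∷ P ++ u ∷ g ++ Q) ≤ c
    crossing {x} {y} {u} {P = P} {Q = Q} wP us wg wQ u! len yu xv with firstOrEnd (G x) wg xv
    ... | v′ , gap , zs , refl , wgap , wzs , xv′ , gapA with last (G y) (cons us wgap)
    ... | inj₁ none = ⊥-elim (false≢true (none (here refl)) yu)
    ... | inj₂ (u′ , s′ , xs , zs′ , eq , wxs , us′ , wzs′ , yu′ , gapB) =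
      subst (λ l → count (G x) (y ∷ l) + count (G y) (y ∷ l) ≤ c) (sym list≡)
        (minimalCrossing (wP ++ʷ wxs) us′ wzs′ (wzs ++ʷ wQ)
          (subst (λ l → Unique (y ∷ l)) list≡ u!) (subst (λ l → c ≤ length l) list≡ len)
          yu′ xv′ (gapA ∘ inGap xs eq) gapB)
      where
      list≡ : P ++ u ∷ (gap ++ zs) ++ Q ≡ (P ++ xs) ++ u′ ∷ zs′ ++ (zs ++ Q)
      list≡ = trans (cong (P ++_) (trans (cong (u ∷_) (++-assoc gap zs Q)) (trans (cong (_++ zs ++ Q) eq) (++-assoc xs (u′ ∷ zs′) _)))) (sym (++-assoc P xs _))
      inGap : ∀ xs → u ∷ gap ≡ xs ++ u′ ∷ zs′ → ∀ {w} → w ∈ zs′ → w ∈ gap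
      inGap [] refl w∈ = w∈
      inGap (_ ∷ xs) refl w∈ = ∈-++⁺ʳ xs (there w∈)

    -- Let `a` be the last neighbour of `x` on the path. Either `y` has a neighbour before `a`, and
    -- the two cross, or its first neighbour `b` is at `a` or later.
    degreeSum : ∀ {x y xs} → Path G x y xs → 1 ≤ c → c ≤ length xs →
      count (G x) (y ∷ xs) + count (G y) (y ∷ xs) ≤ c
    degreeSum {x} {y} {xs} (path w u!) c≥1 len = byLast (last (G x) w)
      where
      goal = count (G x) (y ∷ xs) + count (G y) (y ∷ xs) ≤ c
      nonadjacent : G x y ≡ false
      nonadjacent = ≢true⇒false λ xy → noCycle x (xs ++ y ∷ []) (w ++ʷ cons (sym-true xy) nil)
        (Unique-↭ (++-comm (y ∷ []) xs) u!)
        (subst (c <_) (trans (+-comm 1 (length xs)) (sym (length-++ xs))) (s≤s len))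
      byLast : _ → goal
      byLast (inj₁ none) = ⊥-elim (second w (≤-trans c≥1 len) none)
        where
        second : ∀ {xs} → Walk G x y xs → 1 ≤ length xs → (∀ {v} → v ∈ xs → G x v ≡ false) → ⊥
        second (cons e nil)        _ _ = false≢true nonadjacent e
        second (cons e (cons _ _)) _ h = false≢true (h (there (here refl))) e
      byLast (inj₂ (a , s , g₁ , g₂ , refl , w₁ , as , w₂ , xa , none)) with first (G y) w₁
      ... | inj₂ (u , gap , .(u ∷ _) , refl , wgap , cons {xs = g′} us wg′ , _ , yu , _) =
        subst (λ l → count (G x) (y ∷ l) + count (G y) (y ∷ l) ≤ c) (sym assoc)
          (crossing wgap us wg′ (cons as w₂) (subst (λ l → Unique (y ∷ l)) assoc u!) (subst (λ l → c ≤ length l) assoc len) yu xa)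
        where
        assoc : (gap ++ u ∷ g′) ++ a ∷ g₂ ≡ gap ++ u ∷ g′ ++ a ∷ g₂
        assoc = ++-assoc gap (u ∷ g′) _
      ... | inj₁ noB with first (G y) (cons as w₂)
      ... | inj₁ none′ with penultimate (cons as w₂)
      ... | t , t∈ , ty = ⊥-elim (false≢true (none′ t∈) (sym-true ty))
      byLast (inj₂ (a , s , g₁ , g₂ , refl , w₁ , as , w₂ , xa , none))
        | inj₁ noB | inj₂ (b , gap , X₃ , eq , wgap , wX₃ , b∈ , yb , noGap) with reverseʷ G-sym wX₃
      ... | R , r , R↭ = ≤-trans (≤-reflexive (cong₂ _+_ countA countB))
        (uncrossed pX xa pM pY yb onlyX (λ v∈ v∈′ → gapX₃ v∈ (∈-resp-↭ R↭ v∈′)) XY)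
        where
        u!′ : Unique (y ∷ g₁ ++ gap ++ X₃)
        u!′ = subst (λ l → Unique (y ∷ g₁ ++ l)) eq u!
        g₁! = ++-!⁻ g₁ (tail-! u!)
        gap! : Unique gap × Unique X₃ × (∀ {v} → v ∈ gap → v ∈ X₃ → ⊥)
        gap! = ++-!⁻ gap (subst Unique eq (proj₁ (proj₂ g₁!)))
        y∉ : y ∉ g₁ ++ gap ++ X₃
        y∉ = head-∉ u!′
        gapX₃ : ∀ {v} → v ∈ gap → v ∈ y ∷ X₃ → ⊥
        gapX₃ p (here refl) = y∉ (∈-++⁺ʳ g₁ (∈-++⁺ˡ p))
        gapX₃ p (there q)   = proj₂ (proj₂ gap!) p q
        pX : Path G x a g₁
        pX = path w₁ (cons-! (λ q → proj₂ (proj₂ g₁!) q (here refl)) (proj₁ g₁!))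
        pM : Path G a b gap
        pM = path wgap (cons-! (λ q → gapX₃ q (there b∈)) (proj₁ gap!))
        pY : Path G y b R
        pY = path r (Unique-↭ (↭-sym R↭) (cons-! (λ q → y∉ (∈-++⁺ʳ g₁ (∈-++⁺ʳ gap q))) (proj₁ (proj₂ gap!))))
        later : ∀ {v} → v ∈ g₁ → v ∈ gap ++ X₃ → ⊥
        later p q = proj₂ (proj₂ g₁!) p (subst (_ ∈_) (sym eq) q)
        onlyX : ∀ {v} → v ∈ b ∷ gap → v ∈ a ∷ g₁ → v ≡ a
        onlyX _ (here p) = p
        onlyX (here refl) (there q) = ⊥-elim (later q (∈-++⁺ʳ gap b∈))
        onlyX (there p) (there q)   = ⊥-elim (later q (∈-++⁺ˡ p))
        atA : a ∈ y ∷ X₃ → a ≡ b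
        atA q = case start∈ wgap of λ { (here p) → p ; (there p) → ⊥-elim (gapX₃ p q) }
        XY : ∀ {v} → v ∈ a ∷ g₁ → v ∈ b ∷ R → v ≡ b
        XY p q with ∈-resp-↭ R↭ q
        XY (here refl) q | q′ = atA q′
        XY (there p) q | here refl = ⊥-elim (y∉ (∈-++⁺ˡ p))
        XY (there p) q | there q′ = ⊥-elim (later p (∈-++⁺ʳ gap q′))
        countA : count (G x) (y ∷ g₁ ++ a ∷ g₂) ≡ count (G x) (a ∷ g₁)
        countA = trans (count-false (G x) (g₁ ++ a ∷ g₂) nonadjacent)
          (trans (count-↭ (G x) (shift a g₁ g₂))
          (trans (count-++ (G x) (a ∷ g₁) g₂) (trans (cong (count (G x) (a ∷ g₁) +_) (count-none (G x) g₂ none)) (+-identityʳ _))))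
        countB : count (G y) (y ∷ g₁ ++ a ∷ g₂) ≡ count (G y) (b ∷ R)
        countB = begin
          count (G y) (y ∷ g₁ ++ a ∷ g₂)      ≡⟨ cong (λ l → count (G y) (y ∷ g₁ ++ l)) eq ⟩
          count (G y) (y ∷ g₁ ++ gap ++ X₃)   ≡⟨ count-↭ (G y) (solve 4 (λ y g p q → y ⊕ (g ⊕ (p ⊕ q)) ⊜ g ⊕ (p ⊕ (y ⊕ q))) ↭-refl (y ∷ []) g₁ gap X₃) ⟩
          count (G y) (g₁ ++ gap ++ y ∷ X₃)   ≡⟨ count-++ (G y) g₁ _ ⟩
          count (G y) g₁ + count (G y) (gap ++ y ∷ X₃) ≡⟨ cong₂ _+_ (count-none (G y) g₁ noB) (count-++ (G y) gap _) ⟩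
          count (G y) gap + count (G y) (y ∷ X₃) ≡⟨ cong (_+ count (G y) (y ∷ X₃)) (count-none (G y) gap noGap) ⟩
          count (G y) (y ∷ X₃)                ≡⟨ count-↭ (G y) (↭-sym R↭) ⟩
          count (G y) (b ∷ R)                 ∎
          where open ≡-Reasoning

-- Edge-saturated graphs

LongPath : {n : ℕ} → Graph n → ℕ → Fin n → Fin n → Set
LongPath G c u v = ∃ λ xs → Path G u v xs × c ≤ length xs

_⊑_ : {n : ℕ} → Graph n → Graph n → Set
G ⊑ G′ = ∀ u v → G u v ≡ true → G′ u v ≡ true

LongPath-mono : {n c : ℕ} {G G′ : Graph n} → G ⊑ G′ → ∀ {u v} → LongPath G c u v → LongPath G′ c u v
LongPath-mono le (xs , path w u , len) = xs , path (Walk-mono le w) u , len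

module AddEdge {n : ℕ} (G : Graph n) (u v : Fin n) where

  addEdge : Graph n
  addEdge a b = G a b ∨ ((⌊ a F.≟ u ⌋ ∧ ⌊ b F.≟ v ⌋) ∨ (⌊ a F.≟ v ⌋ ∧ ⌊ b F.≟ u ⌋))

  Added : Fin n → Fin n → Set
  Added a b = (a ≡ u × b ≡ v) ⊎ (a ≡ v × b ≡ u)

  old-or-added : ∀ a b → addEdge a b ≡ true → G a b ≡ true ⊎ Added a b
  old-or-added a b e with G a b
  ... | true = inj₁ refl
  ... | false with a F.≟ u | b F.≟ v | a F.≟ v | b F.≟ u
  ... | yes p | yes q | _     | _     = inj₂ (inj₁ (p , q))
  ... | yes _ | no _  | yes p | yes q = inj₂ (inj₂ (p , q))
  ... | no _  | _     | yes p | yes q = inj₂ (inj₂ (p , q))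
  old-or-added a b () | false | yes _ | no _  | yes _ | no _
  old-or-added a b () | false | yes _ | no _  | no _  | _
  old-or-added a b () | false | no _  | _  | yes _ | no _
  old-or-added a b () | false | no _  | _  | no _  | _

  G⊑addEdge : G ⊑ addEdge
  G⊑addEdge a b e rewrite e = refl

  addEdge-uv : addEdge u v ≡ true
  addEdge-uv with G u v | u F.≟ u | v F.≟ v
  ... | true  | _      | _      = refl
  ... | false | yes _  | yes _  = refl
  ... | false | no u≢u | _      = ⊥-elim (u≢u refl)
  ... | false | _      | no v≢v = ⊥-elim (v≢v refl)

  addEdge-irrefl : u ≢ v → (∀ a → G a a ≡ false) → ∀ a → addEdge a a ≡ false
  addEdge-irrefl u≢v irr a = ≢true⇒false λ e → case old-or-added a a e of λ
    { (inj₁ p) → false≢true (irr a) p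
    ; (inj₂ (inj₁ (refl , p))) → u≢v p
    ; (inj₂ (inj₂ (refl , p))) → u≢v (sym p) }

  addEdge-sym : (∀ a b → G a b ≡ G b a) → ∀ a b → addEdge a b ≡ addEdge b a
  addEdge-sym s a b rewrite s a b with G b a | a F.≟ u | b F.≟ v | a F.≟ v | b F.≟ u
  ... | true  | _     | _     | _     | _     = refl
  ... | false | yes _ | yes _ | yes _ | yes _ = refl
  ... | false | yes _ | yes _ | yes _ | no _  = refl
  ... | false | yes _ | yes _ | no _  | yes _ = refl
  ... | false | yes _ | yes _ | no _  | no _  = refl
  ... | false | yes _ | no _  | yes _ | yes _ = refl
  ... | false | yes _ | no _  | yes _ | no _  = refl
  ... | false | yes _ | no _  | no _  | yes _ = refl
  ... | false | yes _ | no _  | no _  | no _  = refl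
  ... | false | no _  | yes _ | yes _ | yes _ = refl
  ... | false | no _  | yes _ | yes _ | no _  = refl
  ... | false | no _  | yes _ | no _  | yes _ = refl
  ... | false | no _  | yes _ | no _  | no _  = refl
  ... | false | no _  | no _  | yes _ | yes _ = refl
  ... | false | no _  | no _  | yes _ | no _  = refl
  ... | false | no _  | no _  | no _  | yes _ = refl
  ... | false | no _  | no _  | no _  | no _  = refl

  Added-other : ∀ {a b a′ b′} → Added a b → Added a′ b′ → (a′ ≡ a × b′ ≡ b) ⊎ (a′ ≡ b × b′ ≡ a)
  Added-other (inj₁ (refl , refl)) (inj₁ (refl , refl)) = inj₁ (refl , refl)
  Added-other (inj₁ (refl , refl)) (inj₂ (refl , refl)) = inj₂ (refl , refl)
  Added-other (inj₂ (refl , refl)) (inj₁ (refl , refl)) = inj₂ (refl , refl)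
  Added-other (inj₂ (refl , refl)) (inj₂ (refl , refl)) = inj₁ (refl , refl)

  firstAdded : ∀ {x z xs} → Walk addEdge x z xs → Walk G x z xs ⊎
    (∃₂ λ a b → ∃₂ λ ys zs → xs ≡ ys ++ a ∷ zs × Walk G x a ys × Added a b × Walk addEdge b z zs)
  firstAdded nil = inj₁ nil
  firstAdded {x} (cons {w = w} e r) with old-or-added x w e
  ... | inj₂ new = inj₂ (x , w , [] , _ , refl , nil , new , r)
  ... | inj₁ old with firstAdded r
  ... | inj₁ r′ = inj₁ (cons old r′)
  ... | inj₂ (a , b , ys , zs , refl , w₁ , new , w₂) = inj₂ (a , b , x ∷ ys , zs , refl , cons old w₁ , new , w₂)

  avoiding : ∀ {a b} → Added a b → ∀ {w z xs} → Walk addEdge w z xs → a ∉ xs → b ∉ xs → Walk G w z xs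
  avoiding ab nil _ _ = nil
  avoiding ab {w} (cons {w = w′} e r) a∉ b∉ with old-or-added w w′ e
  ... | inj₁ old = cons old (avoiding ab r (a∉ ∘ there) (b∉ ∘ there))
  ... | inj₂ new with Added-other ab new
  ... | inj₁ (refl , _) = ⊥-elim (a∉ (here refl))
  ... | inj₂ (refl , _) = ⊥-elim (b∉ (here refl))

  -- Once the new edge has been used, a duplicate-free walk can meet it again only by going straight
  -- back over it.
  afterAdded : ∀ {a b} → Added a b → ∀ {z xs} → Walk addEdge b z xs → a ∉ xs → Unique xs →
    Walk G b z xs ⊎ (xs ≡ b ∷ [] × z ≡ a)
  afterAdded ab nil _ _ = inj₁ nil
  afterAdded {a} {b} ab (cons {w = w} e r) a∉ u! with old-or-added b w e
  ... | inj₁ old = inj₁ (cons old (avoiding ab r (a∉ ∘ there) (head-∉ u!)))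
  ... | inj₂ new with Added-other ab new | r
  ... | inj₁ (refl , _)    | _ = ⊥-elim (a∉ (here refl))
  ... | inj₂ (_ , refl)    | nil = inj₂ (refl , refl)
  ... | inj₂ (_ , refl)    | cons _ _ = ⊥-elim (a∉ (there (here refl)))

  -- A long cycle must use the new edge; without it, the cycle is a path between `u` and `v` with at
  -- least `c` edges.
  addEdge-noCycle : ∀ {c} → 2 ≤ c → (∀ a b → G a b ≡ G b a) → NoCycleAbove G c → ¬ LongPath G c u v → NoCycleAbove addEdge c
  addEdge-noCycle {c} c≥2 G-sym noCycle noPath x xs w u! len with firstAdded w
  ... | inj₁ w′ = noCycle x xs w′ u! len
  ... | inj₂ (a , b , ys , zs , refl , w₁ , ab , w₂) with ++-!⁻ ys u!
  ... | ys! , azs! , dis with afterAdded ab w₂ (head-∉ azs!) (tail-! azs!)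
  ... | inj₁ w₃ = connect ab
    where
    p↭ : ys ++ a ∷ zs ↭ a ∷ zs ++ ys
    p↭ = ++-comm ys (a ∷ zs)
    pab : Path G b a (zs ++ ys)
    pab = path (w₃ ++ʷ w₁) (Unique-↭ p↭ u!)
    long : c ≤ length (zs ++ ys)
    long = ≤-pred (subst (c <_) (↭-length p↭) len)
    connect : Added a b → ⊥
    connect (inj₂ (refl , refl)) = noPath (_ , pab , long)
    connect (inj₁ (refl , refl)) with reverseʷ G-sym (walk pab)
    ... | R , r , R↭ = noPath (R , path r (Unique-↭ (↭-sym R↭) (unique pab)) ,
      subst (c ≤_) (suc-injective (sym (↭-length R↭))) long)
  -- Going straight back over the new edge gives a closed walk of length 2, which is not longer than
  -- `c`.
  addEdge-noCycle {c} c≥2 G-sym noCycle noPath x xs w u! len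
    | inj₂ (a , b , .[] , zs , refl , nil , ab , w₂) | _ | inj₂ (refl , refl) = <⇒≱ len c≥2
  addEdge-noCycle {c} c≥2 G-sym noCycle noPath x xs w u! len
    | inj₂ (a , b , ys , zs , refl , cons _ _ , ab , w₂) | _ , _ , dis | inj₂ (refl , refl) = dis (here refl) (here refl)

record Extremal {n : ℕ} (c : ℕ) (G : Graph n) : Set where
  field
    G-sym    : ∀ u v → G u v ≡ G v u
    G-irrefl : ∀ v → G v v ≡ false
    noCycle  : NoCycleAbove G c

SaturatedAt : {n : ℕ} → ℕ → Graph n → Fin n × Fin n → Set
SaturatedAt c G (u , v) = u ≢ v → G u v ≡ false → LongPath G c u v

-- One pass over the pairs is enough: edges and long paths survive the addition of edges, so a
-- settled pair stays settled. Whether a long path exists is not decided, hence the double negation.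
saturate : {n c : ℕ} → 2 ≤ c → (ps : List (Fin n × Fin n)) (G : Graph n) → Extremal c G →
  ¬ ¬ (∃ λ G′ → G ⊑ G′ × Extremal c G′ × (∀ {p} → p ∈ ps → SaturatedAt c G′ p))
saturate c≥2 [] G ext k = k (G , (λ _ _ e → e) , ext , λ ())
saturate {n} {c} c≥2 ((u , v) ∷ ps) G ext k = saturate c≥2 ps G ext step
  where
  step : ¬ (∃ λ G′ → G ⊑ G′ × Extremal c G′ × (∀ {p} → p ∈ ps → SaturatedAt c G′ p))
  -- For equal or adjacent `u` and `v`, or with a long path between them, `G′` is saturated at the
  -- pair already; otherwise the edge is added.
  step (G′ , le , ext′ , sat) = already λ u≢v _ → ⊥-elim (already λ _ _ → ⊥-elim (noPathCase u≢v))
    where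
    open Extremal ext′
    already : ¬ SaturatedAt c G′ (u , v)
    already s = k (G′ , le , ext′ , λ { (here refl) → s ; (there p) → sat p })
    noPathCase : u ≢ v → ⊥
    noPathCase u≢v = k (addEdge , (λ a b e → G⊑addEdge a b (le a b e)) ,
      record { G-sym = addEdge-sym G-sym ; G-irrefl = addEdge-irrefl u≢v G-irrefl
             ; noCycle = addEdge-noCycle c≥2 G-sym noCycle λ lp → already λ _ _ → lp } ,
      λ { (here refl) _ e → ⊥-elim (false≢true e addEdge-uv)
        ; (there p) a≢b e → LongPath-mono G⊑addEdge (sat p a≢b (≢true⇒false λ e′ → false≢true e (G⊑addEdge _ _ e′))) })
      where open AddEdge G′ u v

-- Longest paths and the order of deletion

length-allFin : ∀ n → length (allFin n) ≡ n
length-allFin n = length-tabulate {n = n} id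

length≤n : ∀ {n} {xs : List (Fin n)} → Unique xs → length xs ≤ n
length≤n {n} {xs} u = subst (length xs ≤_) (length-allFin n) (length-⊆ u λ _ → ∈-allFin _)

escape : ∀ {n} (p : Fin n → Bool) (T l : List (Fin n)) →
  (∀ {v} → v ∈ T → p v ≡ true → v ∈ l) ⊎ (∃ λ v → v ∈ T × p v ≡ true × v ∉ l)
escape p [] l = inj₁ λ ()
escape p (x ∷ T) l with escape p T l
... | inj₂ (v , v∈ , pv , v∉) = inj₂ (v , there v∈ , pv , v∉)
... | inj₁ all with p x in eq | x ∈? l
... | true  | no  x∉ = inj₂ (x , here refl , eq , x∉)
... | true  | yes x∈ = inj₁ λ { (here refl) _ → x∈ ; (there q) pv → all q pv }
... | false | _      = inj₁ λ { (here refl) pv → ⊥-elim (false≢true eq pv) ; (there q) pv → all q pv }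

data Peels {n : ℕ} (G : Graph n) (s : ℕ) (base : List (Fin n)) : List (Fin n) → Set where
  done : Peels G s base []
  step : ∀ {v rem} → count (G v) (rem ++ base) ≤ s → Peels G s base rem → Peels G s base (v ∷ rem)

module _ {n : ℕ} {G : Graph n} where

  Peels-++ : ∀ {s base} ys {zs} → Peels G s base (ys ++ zs) → Peels G s (zs ++ base) ys
  Peels-++ []       p          = done
  Peels-++ {s} {base} (y ∷ ys) {zs} (step le p) = step (subst (λ l → count (G y) l ≤ s) (++-assoc ys zs base) le) (Peels-++ ys p)

  Peels-base : ∀ {s base rem} → Peels G s base rem → ∀ {v} → v ∈ rem → count (G v) base ≤ s
  Peels-base {base = base} (step {v} {rem} le _) (here refl) =
    ≤-trans (m≤n+m _ (count (G v) rem)) (≤-trans (≤-reflexive (sym (count-++ (G v) rem base))) le)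
  Peels-base (step _ p) (there v∈) = Peels-base p v∈

  smallDegree : ∀ s L T → (∀ {v} → v ∈ L → s < count (G v) T) ⊎ (∃ λ v → v ∈ L × count (G v) T ≤ s)
  smallDegree s [] T = inj₁ λ ()
  smallDegree s (x ∷ L) T with smallDegree s L T
  ... | inj₂ (v , v∈ , le) = inj₂ (v , there v∈ , le)
  ... | inj₁ all with count (G x) T ≤? s
  ... | yes le = inj₂ (x , here refl , le)
  ... | no ¬le = inj₁ λ { (here refl) → ≰⇒> ¬le ; (there q) → all q }

  -- Greedy deletion. `K` is never deleted but counts towards degrees, which allows the second round
  -- of deletions to take place outside the clique.
  peel : ∀ s K fuel L → length L ≤ fuel → ∃₂ λ rem core → L ↭ rem ++ core ×
    Peels G s (core ++ K) rem × (∀ {v} → v ∈ core → s < count (G v) (core ++ K))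
  peel s K fuel L len with smallDegree s L (L ++ K)
  ... | inj₁ all = [] , L , ↭-refl , done , all
  ... | inj₂ (v , v∈ , le) with ∈-∃++ v∈
  peel s K zero .(l₁ ++ v ∷ l₂) len | inj₂ (v , v∈ , le) | l₁ , l₂ , refl =
    ⊥-elim (1+n≰n (≤-trans (s≤s z≤n) (≤-trans (≤-reflexive (sym (↭-length (shift v l₁ l₂)))) len)))
  peel s K (suc fuel) .(l₁ ++ v ∷ l₂) len | inj₂ (v , v∈ , le) | l₁ , l₂ , refl
    with peel s K fuel (l₁ ++ l₂) (≤-pred (≤-trans (≤-reflexive (sym (↭-length (shift v l₁ l₂)))) len))
  ... | rem , core , p , peels , big =
    v ∷ rem , core , ↭-trans (shift v l₁ l₂) (prep v p) , step le′ peels , big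
    where
    open ≤-Reasoning
    le′ : count (G v) (rem ++ core ++ K) ≤ s
    le′ = begin
      count (G v) (rem ++ core ++ K)         ≤⟨ count≤∷ (G v) v (rem ++ core ++ K) ⟩
      count (G v) (v ∷ rem ++ core ++ K)     ≡⟨ cong (λ l → count (G v) (v ∷ l)) (sym (++-assoc rem core K)) ⟩
      count (G v) ((v ∷ rem ++ core) ++ K)   ≡⟨ count-↭ (G v) (++⁺ʳ K (↭-sym (↭-trans (shift v l₁ l₂) (prep v p)))) ⟩
      count (G v) ((l₁ ++ v ∷ l₂) ++ K)      ≤⟨ le ⟩
      s ∎

-- `base` has as many vertices as K_s and K_{c+1-2s} together in G(n,c,s), where these form a
-- clique; of `base` only the size is prescribed.
record PeelOrder {n : ℕ} (G : Graph n) (c s : ℕ) : Set where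
  field
    {rem base}  : List (Fin n)
    exhausts    : allFin n ↭ rem ++ base
    base-length : length base + s ≡ suc c
    peels       : Peels G s base rem

module Extremals {n c : ℕ} (G : Graph n) (ext : Extremal c G) (conn : NoCutVertex G) (c≥2 : 2 ≤ c)
    (saturated : ∀ u v → u ≢ v → G u v ≡ false → LongPath G c u v) where

  open Extremal ext
  open Kopylov G G-sym G-irrefl using (degreeSum; sym-true)

  -- If `x` and `y` were nonadjacent, saturation would give a path between them with at least `c`
  -- edges. A neighbour in `T₁` or `T₂` of the respective end, off the path, either closes a cycle
  -- longer than `c` or prolongs the path, and the new end stays in its set by `grow₁` or `grow₂`.
  -- When no such neighbour is left, Kopylov's lemma contradicts `c < α + β`.
  joined : (S₁ S₂ : Fin n → Set) (T₁ T₂ : List (Fin n)) → Unique T₁ → Unique T₂ → ∀ α β → c < α + β →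
    (∀ {y z} → S₂ y → z ∈ T₁ → z ≢ y → G z y ≡ false → S₁ z) →
    (∀ {x z} → S₁ x → z ∈ T₂ → z ≢ x → G x z ≡ false → S₂ z) →
    (∀ {x} → S₁ x → α ≤ count (G x) T₁) → (∀ {y} → S₂ y → β ≤ count (G y) T₂) →
    ∀ {x y} → S₁ x → S₂ y → x ≢ y → G x y ≡ true
  joined S₁ S₂ T₁ T₂ T₁! T₂! α β c<αβ grow₁ grow₂ deg₁ deg₂ {x} {y} sx sy x≢y with G x y in eq
  ... | true  = refl
  ... | false = ⊥-elim (case saturated x y x≢y eq of λ { (xs , p , len) → extend (suc n) sx sy p len (s≤s (m≤m+n n _)) })
    where
    extend : ∀ fuel {x y xs} → S₁ x → S₂ y → Path G x y xs → c ≤ length xs → n < fuel + length xs → ⊥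
    extend zero sx sy (path w u!) len big = <⇒≱ big (≤-trans (n≤1+n _) (length≤n u!))
    extend (suc fuel) {x} {y} {xs} sx sy (path w u!) len big with escape (G x) T₁ (y ∷ xs) | escape (G y) T₂ (y ∷ xs)
    ... | inj₂ (z , z∈ , xz , z∉) | _ with G z y in zy
    ...   | true  = noCycle z (z ∷ xs ++ y ∷ []) (cons (sym-true xz) (w ++ʷ cons (sym-true zy) nil))
            (Unique-↭ (prep z (++-comm (y ∷ []) xs)) (cons-! z∉ u!))
            (s≤s (≤-trans len (≤-trans (m≤m+n _ 1) (≤-reflexive (sym (length-++ xs))))))
    ...   | false = extend fuel (grow₁ sy z∈ (λ { refl → z∉ (here refl) }) zy) sy
            (path (cons (sym-true xz) w) (Unique-↭ (swap z y ↭-refl) (cons-! z∉ u!)))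
            (≤-trans len (n≤1+n _)) (subst (n <_) (sym (+-suc fuel (length xs))) big)
    extend (suc fuel) {x} {y} {xs} sx sy (path w u!) len big | inj₁ _ | inj₂ (z , z∈ , yz , z∉) with G x z in xz
    ...   | true  = noCycle z (z ∷ xs ++ y ∷ []) (cons (sym-true xz) (w ++ʷ cons yz nil))
            (Unique-↭ (prep z (++-comm (y ∷ []) xs)) (cons-! z∉ u!))
            (s≤s (≤-trans len (≤-trans (m≤m+n _ 1) (≤-reflexive (sym (length-++ xs))))))
    ...   | false = extend fuel sx (grow₂ sx z∈ (λ { refl → z∉ (start∈ w) }) xz)
            (path (w ++ʷ cons yz nil) (Unique-↭ (prep z (++-comm (y ∷ []) xs)) (cons-! z∉ u!)))
            (≤-trans len (≤-trans (n≤1+n _) (≤-reflexive (sym len+1))))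
            (subst (n <_) (trans (sym (+-suc fuel (length xs))) (cong (fuel +_) (sym len+1))) big)
      where
      len+1 : length (xs ++ y ∷ []) ≡ suc (length xs)
      len+1 = trans (length-++ xs) (+-comm (length xs) 1)
    extend (suc fuel) {x} {y} {xs} sx sy p len big | inj₁ in₁ | inj₁ in₂ = <⇒≱ c<αβ (≤-trans
      (+-mono-≤ (≤-trans (deg₁ sx) (count-⊆ (G x) T₁! in₁)) (≤-trans (deg₂ sy) (count-⊆ (G y) T₂! in₂)))
      (degreeSum conn noCycle p (≤-trans (n≤1+n 1) c≥2) len))

  Complete : List (Fin n) → Set
  Complete K = ∀ {x y} → x ∈ K → y ∈ K → x ≢ y → G x y ≡ true

  clique-degree : ∀ {K} → Unique K → Complete K → ∀ {v} → v ∈ K → suc (count (G v) K) ≡ length K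
  clique-degree {K} K! com {v} v∈ with ∈-∃++ v∈
  ... | l₁ , l₂ , refl = begin
    suc (count (G v) (l₁ ++ v ∷ l₂))  ≡⟨ cong suc (count-↭ (G v) (shift v l₁ l₂)) ⟩
    suc (count (G v) (v ∷ l₁ ++ l₂))  ≡⟨ cong suc (count-false (G v) (l₁ ++ l₂) (G-irrefl v)) ⟩
    suc (count (G v) (l₁ ++ l₂))      ≡⟨ cong suc (count-all (G v) (l₁ ++ l₂) λ q → com v∈ (back (there q)) λ { refl → head-∉ K!′ q }) ⟩
    suc (length (l₁ ++ l₂))           ≡⟨ sym (↭-length (shift v l₁ l₂)) ⟩
    length (l₁ ++ v ∷ l₂)             ∎
    where
    open ≡-Reasoning
    K!′ : Unique (v ∷ l₁ ++ l₂)
    K!′ = Unique-↭ (shift v l₁ l₂) K!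
    back : ∀ {w} → w ∈ v ∷ l₁ ++ l₂ → w ∈ l₁ ++ v ∷ l₂
    back = ∈-resp-↭ (↭-sym (shift v l₁ l₂))

  clique-length : ∀ {K} → Unique K → Complete K → 2 ≤ length K → length K ≤ c
  clique-length {[]} _ _ ()
  clique-length {v ∷ []} _ _ (s≤s ())
  clique-length {v ∷ a ∷ l} K! com _ = ≮⇒≥ (noCycle v (v ∷ a ∷ l)
    (cons (com (here refl) (there (here refl)) (λ { refl → head-∉ K! (here refl) }))
      (through a l (tail-! K!) (λ x∈ y∈ → com (there x∈) (there y∈)) λ q → com (there q) (here refl) λ { refl → head-∉ K! q }))
    K!)
    where
    through : ∀ a l → Unique (a ∷ l) → Complete (a ∷ l) → (∀ {w} → w ∈ a ∷ l → G w v ≡ true) → Walk G a v (a ∷ l)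
    through a [] _ _ h = cons (h (here refl)) nil
    through a (b ∷ l) u! com h = cons (com (here refl) (there (here refl)) λ { refl → head-∉ u! (here refl) })
      (through b l (tail-! u!) (λ x∈ y∈ → com (there x∈) (there y∈)) (h ∘ there))

  module _ {k : ℕ} (c<n : c < n) (minDeg : ∀ v → k ≤ count (G v) (allFin n)) where

    t = c / 2

    c<2t+2 : c < suc t + suc t
    c<2t+2 = begin-strict
      c                 ≡⟨ m≡m%n+[m/n]*n c 2 ⟩
      c % 2 + t * 2     <⟨ +-monoˡ-< (t * 2) (m%n<n c 2) ⟩
      2 + t * 2         ≡⟨ arith t ⟩
      suc t + suc t     ∎
      where
      open ≤-Reasoning
      arith : ∀ t → 2 + t * 2 ≡ suc t + suc t
      arith = solve-∀

    2t≤c : t + t ≤ c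
    2t≤c = ≤-trans (≤-reflexive (arith t)) (m/n*n≤m c 2)
      where
      arith : ∀ t → t + t ≡ t * 2
      arith = solve-∀

    -- The last c + 1 - t vertices in the order of deletion become `base`; there are that many
    -- because `c < n`.
    emptyCore : ∀ {R} → allFin n ↭ R → Peels G t [] R → PeelOrder G c t
    emptyCore {R} R↭ peels = record
      { rem = take m R ; base = drop m R
      ; exhausts = subst (allFin n ↭_) (sym (take++drop≡id m R)) R↭
      ; base-length = trans (cong (_+ t) base-len) (m∸n+n≡m t≤)
      ; peels = subst (λ b → Peels G t b (take m R)) (++-identityʳ (drop m R))
          (Peels-++ (take m R) (subst (Peels G t []) (sym (take++drop≡id m R)) peels)) }
      where
      t≤ : t ≤ suc c
      t≤ = ≤-trans (m≤m+n t t) (≤-trans 2t≤c (n≤1+n c))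
      m = n ∸ (suc c ∸ t)
      base-len : length (drop m R) ≡ suc c ∸ t
      base-len = trans (length-drop m R) (trans (cong (_∸ m) (trans (sym (↭-length R↭)) (length-allFin n)))
        (m∸[m∸n]≡n (≤-trans (m∸n≤m (suc c) t) c<n)))

    fullCore : ∀ {R K w} → w ∈ K → allFin n ↭ R ++ K → Peels G t K R → (∀ {v} → v ∈ K → t < count (G v) K) →
      ∃ λ s → k ≤ s × s ≤ t × PeelOrder G c s
    fullCore {R} {K} {w} w∈ all↭ peels big = s , k≤s , s≤t , order
      where
      RK! : Unique R × Unique K × (∀ {v} → v ∈ R → v ∈ K → ⊥)
      RK! = ++-!⁻ R (Unique-↭ all↭ (Uniqueₚ.allFin⁺ n))
      K! : Unique K
      K! = proj₁ (proj₂ RK!)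
      RK∅ : ∀ {v} → v ∈ R → v ∈ K → ⊥
      RK∅ = proj₂ (proj₂ RK!)
      r = length K
      complete : Complete K
      complete = joined (_∈ K) (_∈ K) K K K! K! (suc t) (suc t) c<2t+2 (λ _ z∈ _ _ → z∈) (λ _ z∈ _ _ → z∈) big big
      degreeK : ∀ {v} → v ∈ K → suc (count (G v) K) ≡ r
      degreeK = clique-degree K! complete
      t+2≤r : suc (suc t) ≤ r
      t+2≤r = ≤-trans (s≤s (big w∈)) (≤-reflexive (degreeK w∈))
      r≤c : r ≤ c
      r≤c = clique-length K! complete (≤-trans (s≤s (s≤s z≤n)) t+2≤r)
      -- `v` was deleted with at most t neighbours left, while `K` has at least t + 2 vertices.
      notAll : ∀ {v} → v ∈ R → (∀ {y} → y ∈ K → v ≢ y → G v y ≡ true) → ⊥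
      notAll {v} v∈ h = <⇒≱ (≤-trans (n≤1+n _) t+2≤r) (subst (_≤ t)
        (count-all (G v) K λ y∈ → h y∈ λ { refl → RK∅ v∈ y∈ }) (Peels-base peels v∈))
      β≥ : ∀ {y} → y ∈ K → r ∸ 1 ≤ count (G y) K
      β≥ y∈ = ≤-reflexive (cong (_∸ 1) (sym (degreeK y∈)))
      r-1 : suc (r ∸ 1) ≡ r
      r-1 = m+[n∸m]≡n (≤-trans (s≤s z≤n) t+2≤r)
      someR : ∃ λ v → v ∈ R
      someR = nonempty R (trans (sym (length-allFin n)) (↭-length all↭))
        where
        nonempty : ∀ R → n ≡ length (R ++ K) → ∃ λ v → v ∈ R
        nonempty []      n≡r = ⊥-elim (<⇒≱ c<n (subst (_≤ c) (sym n≡r) r≤c))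
        nonempty (v ∷ _) _   = v , here refl
      k+r≤ : k + r ≤ suc c
      -- Otherwise a deleted vertex, of degree at least `k`, would be joined to all of `K`. While
      -- paths are prolonged, that end stays in `R`: a vertex of `K` is adjacent to the other end,
      -- which is in `K`.
      k+r≤ = ≮⇒≥ λ lt → notAll (proj₂ someR) λ y∈ → joined (_∈ R) (_∈ K) (allFin n) K (Uniqueₚ.allFin⁺ n) K!
        k (r ∸ 1) (≤-pred (≤-trans lt (≤-reflexive (trans (cong (k +_) (sym r-1)) (+-suc k (r ∸ 1))))))
        (λ {y} {z} y∈ _ z≢y zy → [ id , (λ z∈ → ⊥-elim (false≢true zy (complete z∈ y∈ z≢y))) ]′ (∈-++⁻ R (∈-resp-↭ all↭ (∈-allFin z))))
        (λ _ z∈ _ _ → z∈) (λ _ → minDeg _) β≥ (proj₂ someR) y∈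
      s = suc c ∸ r
      s+r : s + r ≡ suc c
      s+r = m∸n+n≡m (≤-trans r≤c (n≤1+n c))
      k≤s : k ≤ s
      k≤s = +-cancelʳ-≤ r k s (≤-trans k+r≤ (≤-reflexive (sym s+r)))
      s≤t : s ≤ t
      s≤t = +-cancelʳ-≤ r s t (begin
        s + r           ≡⟨ s+r ⟩
        suc c           ≤⟨ c<2t+2 ⟩
        suc t + suc t   ≡⟨ sym (+-suc t (suc t)) ⟩
        t + suc (suc t) ≤⟨ +-monoʳ-≤ t t+2≤r ⟩
        t + r           ∎)
        where open ≤-Reasoning
      -- A vertex surviving the second round would have degree at least s + 1, and (s + 1) + (r - 1)
      -- exceeds `c`; it would be joined to all of `K`, against `notAll`.
      order : PeelOrder G c s
      order with peel {G = G} s K (length R) R ≤-refl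
      ... | rem , [] , R↭ , peels′ , _ = record
        { rem = rem ; base = K
        ; exhausts = ↭-trans all↭ (++⁺ʳ K (↭-trans R↭ (↭-reflexive (++-identityʳ rem))))
        ; base-length = trans (+-comm r s) s+r
        ; peels = peels′ }
      ... | rem , x ∷ core , R↭ , _ , big′ = ⊥-elim (notAll (inR (here refl)) (joined (_∈ x ∷ core) (_∈ K) (x ∷ core ++ K) K
            core! K! (suc s) (r ∸ 1) (s≤s′) (λ {y} {z} y∈ z∈ z≢y zy → [ id , (λ z∈ → ⊥-elim (false≢true zy (complete z∈ y∈ z≢y))) ]′ (∈-++⁻ (x ∷ core) z∈))
            (λ _ z∈ _ _ → z∈) big′ β≥ (here refl)))
        where
        inR : ∀ {v} → v ∈ x ∷ core → v ∈ R
        inR v∈ = ∈-resp-↭ (↭-sym R↭) (∈-++⁺ʳ rem v∈)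
        core! : Unique ((x ∷ core) ++ K)
        core! = ++-! (proj₁ (proj₂ (++-!⁻ rem (Unique-↭ R↭ (proj₁ RK!))))) K! λ p q → RK∅ (inR p) q
        s≤s′ : c < suc s + (r ∸ 1)
        s≤s′ = ≤-reflexive (sym (trans (sym (+-suc s (r ∸ 1))) (trans (cong (s +_) r-1) s+r)))

    peelOrder : PeelOrder G c t ⊎ (∃ λ s → k ≤ s × s ≤ t × PeelOrder G c s)
    peelOrder with peel {G = G} t [] n (allFin n) (≤-reflexive (length-allFin n))
    ... | R , []       , all↭ , peels , _   = inj₁ (emptyCore (↭-trans all↭ (↭-reflexive (++-identityʳ R))) peels)
    ... | R , w ∷ core , all↭ , peels , big = inj₂ (fullCore (here refl) all↭
      (subst (λ l → Peels G t l R) (++-identityʳ (w ∷ core)) peels)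
      (λ {v} v∈ → subst (λ l → t < count (G v) l) (++-identityʳ (w ∷ core)) (big v∈)))

-- From the given definitions to walks

lookup-injective : {A : Set} {xs : List A} → Unique xs → ∀ i j → lookup xs i ≡ lookup xs j → i ≡ j
lookup-injective {xs = x ∷ xs} u fzero    fzero    e = refl
lookup-injective {xs = x ∷ xs} u fzero    (fsuc j) e = ⊥-elim (head-∉ u (subst (_∈ xs) (sym e) (∈-lookup j)))
lookup-injective {xs = x ∷ xs} u (fsuc i) fzero    e = ⊥-elim (head-∉ u (subst (_∈ xs) e (∈-lookup i)))
lookup-injective {xs = x ∷ xs} u (fsuc i) (fsuc j) e = cong fsuc (lookup-injective (tail-! u) i j e)

module _ {n : ℕ} {G : Graph n} where

  lookup-step : ∀ {u v xs} → Walk G u v xs → ∀ i j → toℕ j ≡ suc (toℕ i) → G (lookup xs i) (lookup xs j) ≡ true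
  lookup-step (cons e (cons _ _)) fzero (fsuc fzero) refl = e
  lookup-step (cons e w) (fsuc i) (fsuc j) eq = lookup-step w i j (suc-injective eq)

  lookup-last : ∀ {u v xs} → Walk G u v xs → ∀ i → toℕ i ≡ length xs ∸ 1 → G (lookup xs i) v ≡ true
  lookup-last (cons e nil)          fzero    _  = e
  lookup-last (cons e w@(cons _ _)) (fsuc i) eq = lookup-last w i (suc-injective eq)

  lookup-first : ∀ {u v xs} → Walk G u v xs → ∀ i → toℕ i ≡ 0 → lookup xs i ≡ u
  lookup-first (cons e w) fzero _ = refl

  hasCycle : ∀ {u xs} → Walk G u u xs → Unique xs → 3 ≤ length xs → HasCycleOfLength G (length xs)
  hasCycle {xs = xs} w u! len = lookup xs , len , lookup-injective u! , λ
    { i j (inj₁ e) → lookup-step w i j e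
    ; i j (inj₂ (e , e′)) → subst (λ v → G (lookup xs i) v ≡ true) (sym (lookup-first w j e′)) (lookup-last w i e) }

  noCycleAbove : ∀ {c} → Circumference G c → NoCycleAbove G c
  noCycleAbove ((_ , c≥3 , _) , max) u xs w u! len =
    <⇒≱ len (max (length xs) (hasCycle w u! (≤-trans c≥3 (≤-trans (n≤1+n _) len))))

  -- This is where the graph being nonhamiltonian enters: a longest cycle misses some vertex.
  circumference<n : ∀ {c} → Circumference G c → ¬ Hamiltonian G → c < n
  circumference<n {c} (cyc@(f , _ , inj , _) , _) ¬ham =
    ≤∧≢⇒< (injective⇒≤ {f = f} (inj _ _)) λ { refl → ¬ham cyc }

  toWalk : (P : Fin n → Set) (l : ℕ) (w : Fin (suc l) → Fin n) → (∀ i → P (w i)) →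
    (∀ (i : Fin l) → G (w (inject₁ i)) (w (fsuc i)) ≡ true) →
    ∃ λ xs → Walk G (w fzero) (w (fromℕ l)) xs × (∀ {v} → v ∈ xs → P v)
  toWalk P zero    w p e = [] , nil , λ ()
  toWalk P (suc l) w p e with toWalk P l (w ∘ fsuc) (p ∘ fsuc) (e ∘ fsuc)
  ... | xs , q , h = w fzero ∷ xs , cons (e fzero) q , λ { (here refl) → p fzero ; (there m) → h m }

  noCutVertex : TwoConnected G → NoCutVertex G
  noCutVertex (_ , conn) x u v u≢x v≢x with conn x u v u≢x v≢x
  ... | l , w , refl , refl , p , e with toWalk (λ z → z ≡ x → ⊥) l w p e
  ... | xs , q , h = xs , q , λ { (here eq) → p (fromℕ l) (sym eq) ; (there x∈) → h x∈ refl }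

module _ {n : ℕ} {G G′ : Graph n} (le : G ⊑ G′) where

  -- Removing edges only lowers degrees, so the order found in the saturated graph serves the
  -- original one.
  PeelOrder-⊑ : ∀ {c s} → PeelOrder G′ c s → PeelOrder G c s
  PeelOrder-⊑ {s = s} o = record { exhausts = exhausts ; base-length = base-length ; peels = Peels-⊑ peels }
    where
    open PeelOrder o
    Peels-⊑ : ∀ {base rem} → Peels G′ s base rem → Peels G s base rem
    Peels-⊑ done        = done
    Peels-⊑ {base} (step {v} {rem} d p) = step (≤-trans (count-mono (rem ++ base) λ {u} _ → le v u) d) (Peels-⊑ p)

  NoCutVertex-⊑ : NoCutVertex G → NoCutVertex G′
  NoCutVertex-⊑ conn x u v u≢x v≢x with conn x u v u≢x v≢x
  ... | xs , w , x∉ = xs , Walk-mono le w , x∉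

allPairs : ∀ n → List (Fin n × Fin n)
allPairs n = cartesianProduct (allFin n) (allFin n)

peelOrder-of-nonhamiltonian : {n c k : ℕ} (G : Graph n) → IsSimple G → TwoConnected G → ¬ Hamiltonian G →
  Circumference G c → MinDegreeAtLeast G k →
  ¬ ¬ (PeelOrder G c (c / 2) ⊎ (∃ λ s → k ≤ s × s ≤ c / 2 × PeelOrder G c s))
peelOrder-of-nonhamiltonian {n} {c} {k} G (G-sym , G-irrefl) conn ¬ham circ minDeg goal =
  saturate c≥2 (allPairs n) G (record { G-sym = G-sym ; G-irrefl = G-irrefl ; noCycle = noCycleAbove circ })
    λ { (G′ , le , ext , sat) → goal (descend le (Extremals.peelOrder G′ ext (NoCutVertex-⊑ le (noCutVertex conn)) c≥2
          (λ u v → sat (∈-cartesianProduct⁺ (∈-allFin u) (∈-allFin v)))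
          (circumference<n {G = G} circ ¬ham)
          (λ v → ≤-trans (minDeg v) (count-mono (allFin n) λ {u} _ → le v u)))) }
  where
  c≥2 : 2 ≤ c
  c≥2 = ≤-trans (n≤1+n 2) (proj₁ (proj₂ (proj₁ circ)))
  descend : ∀ {G′ : Graph n} → G ⊑ G′ → PeelOrder G′ c (c / 2) ⊎ (∃ λ s → k ≤ s × s ≤ c / 2 × PeelOrder G′ c s) →
    PeelOrder G c (c / 2) ⊎ (∃ λ s → k ≤ s × s ≤ c / 2 × PeelOrder G c s)
  descend le (inj₁ o) = inj₁ (PeelOrder-⊑ le o)
  descend le (inj₂ (s , k≤s , s≤t , o)) = inj₂ (s , k≤s , s≤t , PeelOrder-⊑ le o)

-- Counting copies

filter-split : {A : Set} {P : A → Set} (P? : Decidable P) (l : List A) →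
  l ↭ filter P? l ++ filter (¬? ∘ P?) l
filter-split P? [] = ↭-refl
filter-split P? (x ∷ l) with P? x
... | yes _ = prep x (filter-split P? l)
... | no  _ = ↭-trans (prep x (filter-split P? l)) (↭-sym (shift x (filter P? l) _))

length-filter-split : {A : Set} {P : A → Set} (P? : Decidable P) (l : List A) →
  length l ≡ length (filter P? l) + length (filter (¬? ∘ P?) l)
length-filter-split P? l = trans (↭-length (filter-split P? l)) (length-++ (filter P? l))

-- The two lengths add up to the sizes of union and intersection, and inclusion holds for unions and
-- for intersections.
pairwise-length-≤ : {A : Set} → ((x y : A) → Dec (x ≡ y)) → {L₁ L₂ M₁ M₂ : List A} →
  Unique L₁ → Unique L₂ → Unique M₁ → Unique M₂ →
  (∀ {x} → x ∈ L₁ → x ∈ M₁ ⊎ x ∈ M₂) → (∀ {x} → x ∈ L₂ → x ∈ M₁ ⊎ x ∈ M₂) →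
  (∀ {x} → x ∈ L₁ → x ∈ L₂ → x ∈ M₁ × x ∈ M₂) →
  length L₁ + length L₂ ≤ length M₁ + length M₂
pairwise-length-≤ {A} _≟ᴬ_ {L₁} {L₂} {M₁} {M₂} L₁! L₂! M₁! M₂! h₁ h₂ h₁₂ = begin
  length L₁ + length L₂                     ≡⟨ cong (_+ length L₂) (length-filter-split inL₂ L₁) ⟩
  (length I + length D) + length L₂         ≡⟨ +-assoc (length I) _ _ ⟩
  length I + (length D + length L₂)         ≡⟨ cong (length I +_) (sym (length-++ D)) ⟩
  length I + length (D ++ L₂)               ≤⟨ +-mono-≤ (length-⊆ I! I⊆) (length-⊆ DL₂! DL₂⊆) ⟩
  length J + length (K ++ M₂)               ≡⟨ cong (length J +_) (length-++ K) ⟩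
  length J + (length K + length M₂)         ≡⟨ sym (+-assoc (length J) _ _) ⟩
  (length J + length K) + length M₂         ≡⟨ cong (_+ length M₂) (sym (length-filter-split inM₂ M₁)) ⟩
  length M₁ + length M₂                     ∎
  where
  open ≤-Reasoning
  inL₂ : Decidable (_∈ L₂)
  inL₂ x = DecMembership._∈?_ _≟ᴬ_ x L₂
  inM₂ : Decidable (_∈ M₂)
  inM₂ x = DecMembership._∈?_ _≟ᴬ_ x M₂
  I D J K : List A
  I = filter inL₂ L₁
  D = filter (¬? ∘ inL₂) L₁
  J = filter inM₂ M₁
  K = filter (¬? ∘ inM₂) M₁
  I! : Unique I
  I! = Uniqueₚ.filter⁺ inL₂ L₁!
  I⊆ : ∀ {x} → x ∈ I → x ∈ J
  I⊆ x∈ with ∈-filter⁻ inL₂ {xs = L₁} x∈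
  ... | x∈L₁ , x∈L₂ with h₁₂ x∈L₁ x∈L₂
  ... | p , q = ∈-filter⁺ inM₂ p q
  DL₂! : Unique (D ++ L₂)
  DL₂! = ++-! (Uniqueₚ.filter⁺ (¬? ∘ inL₂) L₁!) L₂! λ p q → proj₂ (∈-filter⁻ (¬? ∘ inL₂) {xs = L₁} p) q
  sort : ∀ {x} → x ∈ M₁ ⊎ x ∈ M₂ → x ∈ K ++ M₂
  sort (inj₂ q) = ∈-++⁺ʳ K q
  sort {x} (inj₁ p) with inM₂ x
  ... | yes q = ∈-++⁺ʳ K q
  ... | no ¬q = ∈-++⁺ˡ (∈-filter⁺ (¬? ∘ inM₂) p ¬q)
  DL₂⊆ : ∀ {x} → x ∈ D ++ L₂ → x ∈ K ++ M₂
  DL₂⊆ x∈ with ∈-++⁻ D x∈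
  ... | inj₁ p = sort (h₁ (proj₁ (∈-filter⁻ (¬? ∘ inL₂) {xs = L₁} p)))
  ... | inj₂ q = sort (h₂ q)

-- An injection given as a relation, since the image of a subgraph is constructed from a proof that
-- it is a copy.
relation-length-≤ : {A B : Set} (R : A → B → Set) {xs : List A} {ys : List B} → Unique xs →
  (∀ {x} → x ∈ xs → ∃ λ y → y ∈ ys × R x y) → (∀ {x x′ y} → R x y → R x′ y → x ≡ x′) →
  length xs ≤ length ys
relation-length-≤ R {[]} _ _ _ = z≤n
relation-length-≤ R {x ∷ xs} u h inj with h (here refl)
... | y , y∈ , rxy with ∈-∃++ y∈
... | l₁ , l₂ , refl = ≤-trans (s≤s (relation-length-≤ R (tail-! u) h′ inj)) (≤-reflexive (sym (↭-length (shift y l₁ l₂))))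
  where
  h′ : ∀ {x′} → x′ ∈ xs → ∃ λ y′ → y′ ∈ l₁ ++ l₂ × R x′ y′
  h′ {x′} x′∈ with h (there x′∈)
  ... | y′ , y′∈ , r with ∈-resp-↭ (shift y l₁ l₂) y′∈
  ... | there q = y′ , q , r
  ... | here refl with inj rxy r
  ... | refl = ⊥-elim (head-∉ u x′∈)

module _ {n : ℕ} where

  vertex : SubG n → Fin n → Bool
  vertex (S , _) v = lookupᵥ S v

  edge : SubG n → Fin n → Fin n → Bool
  edge (_ , E) u v = lookupᵥ (lookupᵥ E u) v

  SubG-ext : {x y : SubG n} → (∀ v → vertex x v ≡ vertex y v) → (∀ u v → edge x u v ≡ edge y u v) → x ≡ y
  SubG-ext {S , E} {S′ , E′} hS hE = cong₂ _,_ (vec-ext hS) (vec-ext λ u → vec-ext (hE u))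
    where
    vec-ext : {A : Set} {m : ℕ} {v w : Vec A m} → (∀ i → lookupᵥ v i ≡ lookupᵥ w i) → v ≡ w
    vec-ext {v = v} {w} h = trans (sym (Vecₚ.tabulate∘lookup v)) (trans (Vecₚ.tabulate-cong h) (Vecₚ.tabulate∘lookup w))

  _≟ˢ_ : (x y : SubG n) → Dec (x ≡ y)
  _≟ˢ_ = Productₚ.≡-dec (Vecₚ.≡-dec _≟ᵇ_) (Vecₚ.≡-dec (Vecₚ.≡-dec _≟ᵇ_))

  relabel : Permutation′ n → SubG n → SubG n
  relabel π x = tabulate (λ v → vertex x (π ⟨$⟩ˡ v)) , tabulate λ u → tabulate λ v → edge x (π ⟨$⟩ˡ u) (π ⟨$⟩ˡ v)

  vertex-relabel : ∀ π x v → vertex (relabel π x) v ≡ vertex x (π ⟨$⟩ˡ v)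
  vertex-relabel π x v = Vecₚ.lookup∘tabulate _ v

  edge-relabel : ∀ π x u v → edge (relabel π x) u v ≡ edge x (π ⟨$⟩ˡ u) (π ⟨$⟩ˡ v)
  edge-relabel π x u v = trans (cong (λ r → lookupᵥ r v) (Vecₚ.lookup∘tabulate _ u)) (Vecₚ.lookup∘tabulate _ v)

  relabel-injective : ∀ π {x y} → relabel π x ≡ relabel π y → x ≡ y
  relabel-injective π {x} {y} e = SubG-ext
    (λ v → trans (sym (at x v)) (trans (cong (λ z → vertex z (π ⟨$⟩ʳ v)) e) (at y v)))
    (λ u v → trans (sym (at₂ x u v)) (trans (cong (λ z → edge z (π ⟨$⟩ʳ u) (π ⟨$⟩ʳ v)) e) (at₂ y u v)))
    where
    at : ∀ x v → vertex (relabel π x) (π ⟨$⟩ʳ v) ≡ vertex x v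
    at x v = trans (vertex-relabel π x _) (cong (vertex x) (inverseˡ π))
    at₂ : ∀ x u v → edge (relabel π x) (π ⟨$⟩ʳ u) (π ⟨$⟩ʳ v) ≡ edge x u v
    at₂ x u v = trans (edge-relabel π x _ _) (cong₂ (edge x) (inverseˡ π) (inverseˡ π))

  module _ {m : ℕ} {H : Graph m} where

    edge⇒adjacent : ∀ X x → IsCopy H X x → ∀ u v → edge x u v ≡ true → X u v ≡ true
    edge⇒adjacent X x (f , _ , hom , _ , hE) u v e with Equivalence.to (hE u v) e
    ... | i , j , refl , refl , hij = hom i j hij

    IsCopy-of-edges : ∀ X Y x → IsCopy H X x → (∀ u v → edge x u v ≡ true → Y u v ≡ true) → IsCopy H Y x
    IsCopy-of-edges X Y x (f , inj , hom , hS , hE) h =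
      f , inj , (λ i j hij → h _ _ (Equivalence.from (hE (f i) (f j)) (i , j , refl , refl , hij))) , hS , hE

    IsCopy-relabel : ∀ X Y x π → IsCopy H X x →
      (∀ u v → edge x u v ≡ true → Y (π ⟨$⟩ʳ u) (π ⟨$⟩ʳ v) ≡ true) → IsCopy H Y (relabel π x)
    IsCopy-relabel X Y x π (f , inj , hom , hS , hE) h =
      (λ i → π ⟨$⟩ʳ f i) ,
      (λ i j e → inj i j (trans (sym (inverseˡ π)) (trans (cong (π ⟨$⟩ˡ_) e) (inverseˡ π)))) ,
      (λ i j hij → h _ _ (Equivalence.from (hE (f i) (f j)) (i , j , refl , refl , hij))) ,
      (λ v → mk⇔
        (λ e → case Equivalence.to (hS _) (trans (sym (vertex-relabel π x v)) e) of λ { (i , p) → i , toʳ p })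
        (λ { (i , p) → trans (vertex-relabel π x v) (Equivalence.from (hS _) (i , toˡ p)) })) ,
      (λ u v → mk⇔
        (λ e → case Equivalence.to (hE _ _) (trans (sym (edge-relabel π x u v)) e) of
          λ { (i , j , p , q , hij) → i , j , toʳ p , toʳ q , hij })
        (λ { (i , j , p , q , hij) → trans (edge-relabel π x u v) (Equivalence.from (hE _ _) (i , j , toˡ p , toˡ q , hij)) }))
      where
      toʳ : ∀ {a b} → a ≡ π ⟨$⟩ˡ b → π ⟨$⟩ʳ a ≡ b
      toʳ refl = inverseʳ π
      toˡ : ∀ {a b} → π ⟨$⟩ʳ a ≡ b → a ≡ π ⟨$⟩ˡ b
      toˡ refl = sym (inverseˡ π)

    numCopies-≤ : ∀ X Y {N M} → NumCopies H X N → NumCopies H Y M → (R : SubG n → SubG n → Set) →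
      (∀ x → IsCopy H X x → ∃ λ y → IsCopy H Y y × R x y) → (∀ {x x′ y} → R x y → R x′ y → x ≡ x′) → N ≤ M
    numCopies-≤ X Y (L , L! , copies , _ , refl) (M , _ , _ , complete , refl) R h inj =
      relation-length-≤ R L! (λ x∈ → case h _ (All.lookup copies x∈) of λ { (y , cy , r) → y , complete y cy , r }) inj

vectors : {A : Set} → List A → ∀ n → List (Vec A n)
vectors l zero    = Vec.[] ∷ []
vectors l (suc n) = cartesianProductWith Vec._∷_ l (vectors l n)

∈-vectors : {A : Set} {l : List A} → (∀ a → a ∈ l) → ∀ {n} (v : Vec A n) → v ∈ vectors l n
∈-vectors all Vec.[]      = here refl
∈-vectors all (a Vec.∷ v) = ∈-cartesianProductWith⁺ Vec._∷_ (all a) (∈-vectors all v)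

subgraphs : ∀ n → List (SubG n)
subgraphs n = cartesianProduct (vectors bools n) (vectors (vectors bools n) n)
  where bools = true ∷ false ∷ []

∈-subgraphs : ∀ {n} (x : SubG n) → x ∈ subgraphs n
∈-subgraphs (S , E) = ∈-cartesianProduct⁺ (∈-vectors all S) (∈-vectors (∈-vectors all) E)
  where
  all : ∀ b → b ∈ true ∷ false ∷ []
  all true  = here refl
  all false = there (here refl)

-- The subgraphs form a finite list, but being a copy is not decided; excluded middle is applied to
-- each of them under the double negation.
numCopies-exists : ∀ {m n} (H : Graph m) (X : Graph n) → ¬ ¬ (∃ λ N → NumCopies H X N)
numCopies-exists {n = n} H X k = collect (subgraphs n) λ { (L , L! , copies , complete) →
  k (length L , L , L! , copies , (λ x cx → complete (∈-subgraphs x) cx) , refl) }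
  where
  collect : ∀ U → ¬ ¬ (∃ λ L → Unique L × All (IsCopy H X) L × (∀ {x} → x ∈ U → IsCopy H X x → x ∈ L))
  collect []      k = k ([] , [] , [] , λ ())
  collect (x ∷ U) k = collect U λ { (L , L! , copies , complete) → ¬¬-excluded-middle λ
    { (no ¬cx) → k (L , L! , copies , λ { (here refl) cx → ⊥-elim (¬cx cx) ; (there p) → complete p })
    ; (yes cx) → case DecMembership._∈?_ _≟ˢ_ x L of λ
      { (yes x∈) → k (L , L! , copies , λ { (here refl) _ → x∈ ; (there p) → complete p })
      ; (no x∉)  → k (x ∷ L , cons-! x∉ L! , cx ∷ copies , λ { (here refl) _ → here refl ; (there p) c → there (complete p c) }) } } }

-- Comparison with G(n,c,s)

module _ {n : ℕ} where

  position : List (Fin n) → Fin n → ℕ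
  position []      v = 0
  position (x ∷ T) v with x F.≟ v
  ... | yes _ = 0
  ... | no  _ = suc (position T v)

  position-< : ∀ {v} A B → v ∈ A → position (A ++ B) v < length A
  position-< {v} (x ∷ A) B v∈ with x F.≟ v | v∈
  ... | yes _  | _          = s≤s z≤n
  ... | no x≢v | here refl  = ⊥-elim (x≢v refl)
  ... | no _   | there v∈A  = s≤s (position-< A B v∈A)

  position-≡ : ∀ {v} A B → v ∉ A → position (A ++ v ∷ B) v ≡ length A
  position-≡ {v} []      B _ with v F.≟ v
  ... | yes _  = refl
  ... | no v≢v = ⊥-elim (v≢v refl)
  position-≡ {v} (x ∷ A) B v∉ with x F.≟ v
  ... | yes refl = ⊥-elim (v∉ (here refl))
  ... | no _     = cong suc (position-≡ A B (v∉ ∘ there))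

  position<length : ∀ {v} T → v ∈ T → position T v < length T
  position<length {v} T v∈ = subst (λ l → position l v < length T) (++-identityʳ T) (position-< T [] v∈)

  lookup-position : ∀ {v} T → v ∈ T → ∀ i → toℕ i ≡ position T v → lookup T i ≡ v
  lookup-position {v} (x ∷ T) v∈ i e with x F.≟ v | v∈ | i
  ... | yes p  | _          | fzero  = p
  ... | no x≢v | here refl  | _      = ⊥-elim (x≢v refl)
  ... | no _   | there v∈T  | fsuc j = lookup-position T v∈T j (suc-injective e)

  position-lookup : ∀ T → Unique T → ∀ i → position T (lookup T i) ≡ toℕ i
  position-lookup (x ∷ T) u fzero with x F.≟ x
  ... | yes _  = refl
  ... | no x≢x = ⊥-elim (x≢x refl)
  position-lookup (x ∷ T) u (fsuc i) with x F.≟ lookup T i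
  ... | yes e = ⊥-elim (head-∉ u (subst (_∈ T) (sym e) (∈-lookup i)))
  ... | no _  = cong suc (position-lookup T (tail-! u) i)

  module ListPermutation (T : List (Fin n)) (T↭ : allFin n ↭ T) where

    length-T : length T ≡ n
    length-T = trans (sym (↭-length T↭)) (length-allFin n)

    v∈T : ∀ v → v ∈ T
    v∈T v = ∈-resp-↭ T↭ (∈-allFin v)

    position<n : ∀ v → position T v < n
    position<n v = subst (position T v <_) length-T (position<length T (v∈T v))

    π : Permutation′ n
    π = permutation (λ v → fromℕ< (position<n v)) (λ i → lookup T (cast (sym length-T) i))
      (λ i → toℕ-injective (trans (toℕ-fromℕ< (position<n _))
        (trans (position-lookup T (Unique-↭ T↭ (Uniqueₚ.allFin⁺ n)) _) (toℕ-cast (sym length-T) i))))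
      (λ v → lookup-position T (v∈T v) _ (trans (toℕ-cast (sym length-T) _) (toℕ-fromℕ< (position<n v))))

    toℕ-π : ∀ v → toℕ (π ⟨$⟩ʳ v) ≡ position T v
    toℕ-π v = toℕ-fromℕ< (position<n v)

length-filter : {A : Set} (p : A → Bool) (l : List A) → length (filter (λ u → p u ≟ᵇ true) l) ≡ count p l
length-filter p [] = refl
length-filter p (x ∷ l) with p x
... | true  = cong suc (length-filter p l)
... | false = length-filter p l

-- For simple graphs this says that nonadjacency is transitive, which characterises the complete
-- multipartite graphs.
CoTransitive : {m : ℕ} → Graph m → Set
CoTransitive H = ∀ i j h → H i j ≡ true → H i h ≡ true ⊎ H j h ≡ true

-- The copies whose top vertex (the first vertex of the copy in rem) is the m-th vertex of rem
-- are relabelled by their positions in target [] rem m: the later neighbours of the top vertex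
-- come first, then its later non-neighbours, then the top vertex itself.
module Compress {n : ℕ} (G : Graph n) (G-sym : ∀ u v → G u v ≡ G v u) (G-irrefl : ∀ v → G v v ≡ false)
    {h : ℕ} (H : Graph h) (cotrans : CoTransitive H) (s : ℕ) (base : List (Fin n)) where

  adjacent? : ∀ v u → Dec (G v u ≡ true)
  adjacent? v u = G v u ≟ᵇ true

  near far : Fin n → List (Fin n) → List (Fin n)
  near v l = filter (adjacent? v) l
  far v l  = filter (λ u → ¬? (adjacent? v u)) l

  target : List (Fin n) → List (Fin n) → ℕ → List (Fin n)
  target pre []        _       = base ++ pre
  target pre (v ∷ rem) zero    = near v (rem ++ base) ++ far v (rem ++ base) ++ v ∷ pre
  target pre (v ∷ rem) (suc m) = target (v ∷ pre) rem m

  target-↭ : ∀ pre rem m → pre ++ rem ++ base ↭ target pre rem m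
  target-↭ pre [] m = ++-comm pre base
  target-↭ pre (v ∷ rem) zero = ↭-trans (++-comm pre (v ∷ rem ++ base))
    (↭-trans (↭-sym (shift v (rem ++ base) pre))
    (↭-trans (++⁺ʳ (v ∷ pre) (filter-split (adjacent? v) (rem ++ base)))
    (↭-reflexive (++-assoc (near v (rem ++ base)) _ _))))
  target-↭ pre (v ∷ rem) (suc m) = ↭-trans (shift v pre (rem ++ base)) (target-↭ (v ∷ pre) rem m)

  -- By `below` and `top`, the highest position of a copy is exactly |base| + r - m - 1 if `m < r`,
  -- so that `m` can be recovered from the image; `m` equal to `r` stands for the copies inside
  -- `base`. `edges` is adjacency in G(n,c,s), in terms of positions.
  record Placed (T : List (Fin n)) (r m : ℕ) (x : SubG n) : Set where
    field
      m≤r   : m ≤ r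
      below : ∀ u → vertex x u ≡ true → position T u < length base + (r ∸ m)
      top   : m < r → ∃ λ u → vertex x u ≡ true × suc (position T u) + m ≡ length base + r
      edges : ∀ u w → edge x u w ≡ true →
        position T u < s ⊎ position T w < s ⊎ (position T u < length base × position T w < length base)

  -- `pre` collects the vertices of the order passed over because the copy avoids them; they go to
  -- the end of the target list.
  place : ∀ x → IsCopy H G x → ∀ pre rem → Peels G s base rem → Unique (pre ++ rem ++ base) →
    (∀ v → vertex x v ≡ true → v ∈ rem ++ base) → ∃ λ m → Placed (target pre rem m) (length rem) m x
  place x copy@(f , _ , hom , hS , hE) pre [] _ T! inside = 0 , record
    { m≤r = z≤n
    ; below = λ u u∈ → subst (position (base ++ pre) u <_) (sym (+-identityʳ (length base))) (position-< base pre (inside u u∈))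
    ; top = λ ()
    ; edges = λ u w e → inj₂ (inj₂ (case Equivalence.to (hE u w) e of λ
        { (i , j , refl , refl , _) → inBase i , inBase j })) }
    where
    inBase : ∀ i → position (base ++ pre) (f i) < length base
    inBase i = position-< base pre (inside (f i) (Equivalence.from (hS (f i)) (i , refl)))
  place x copy@(f , _ , hom , hS , hE) pre (v ∷ rem) (step deg peels) T! inside with vertex x v in v∈x
  ... | false = shifted (place x copy (v ∷ pre) rem peels (Unique-↭ (shift v pre (rem ++ base)) T!)
          λ u u∈ → case inside u u∈ of λ { (here refl) → ⊥-elim (false≢true v∈x u∈) ; (there q) → q })
    where
    shifted : (∃ λ m → Placed (target (v ∷ pre) rem m) (length rem) m x) →
      ∃ λ m → Placed (target pre (v ∷ rem) m) (suc (length rem)) m x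
    shifted (m , p) = suc m , record
      { m≤r = s≤s m≤r ; below = below ; edges = edges
      ; top = λ { (s≤s m<r) → case top m<r of λ
          { (u , u∈ , e) → u , u∈ , trans (+-suc _ m) (trans (cong suc e) (sym (+-suc (length base) (length rem)))) } } }
      where open Placed p
  ... | true = 0 , record
    { m≤r = z≤n
    ; below = λ u u∈ → below′ (inside u u∈)
    ; top = λ _ → v , v∈x , trans (+-identityʳ _) (trans (cong suc position-v) (sym (+-suc (length base) (length rem))))
    ; edges = λ u w e → case Equivalence.to (hE u w) e of λ { (i , j , refl , refl , hij) → edges′ i j hij } }
    where
    rest = rem ++ base
    N = near v rest
    F = far v rest
    T = N ++ F ++ v ∷ pre
    length-NF : length (N ++ F) ≡ length base + length rem
    length-NF = trans (sym (↭-length (filter-split (adjacent? v) rest))) (trans (length-++ rem) (+-comm (length rem) _))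
    assoc : T ≡ (N ++ F) ++ v ∷ pre
    assoc = sym (++-assoc N F _)
    v∉rest : v ∉ rest
    v∉rest = head-∉ (proj₁ (proj₂ (++-!⁻ pre T!)))
    v∉NF : v ∉ N ++ F
    v∉NF q = v∉rest (∈-resp-↭ (↭-sym (filter-split (adjacent? v) rest)) q)
    position-v : position T v ≡ length base + length rem
    position-v = trans (cong (λ l → position l v) assoc) (trans (position-≡ (N ++ F) pre v∉NF) length-NF)
    below′ : ∀ {u} → u ∈ v ∷ rest → position T u < length base + suc (length rem)
    below′ (here refl) = ≤-reflexive (trans (cong suc position-v) (sym (+-suc (length base) (length rem))))
    below′ {u} (there q) = ≤-trans (subst (λ l → position l u < length (N ++ F)) (sym assoc)
        (position-< (N ++ F) (v ∷ pre) (∈-resp-↭ (filter-split (adjacent? v) rest) q)))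
      (≤-trans (≤-reflexive length-NF) (+-monoʳ-≤ (length base) (n≤1+n _)))
    low : ∀ i → G v (f i) ≡ true → position T (f i) < s
    low i e with inside (f i) (Equivalence.from (hS (f i)) (i , refl))
    ... | here p = ⊥-elim (false≢true (G-irrefl v) (trans (cong (G v) (sym p)) e))
    ... | there q = ≤-trans (position-< N (F ++ v ∷ pre) (∈-filter⁺ (adjacent? v) q e))
      (≤-trans (≤-reflexive (length-filter (G v) rest)) deg)
    edges′ : ∀ i j → H i j ≡ true →
      position T (f i) < s ⊎ position T (f j) < s ⊎ (position T (f i) < length base × position T (f j) < length base)
    edges′ i j hij with Equivalence.to (hS v) v∈x
    -- The top vertex is `f h`. One end of each edge is adjacent to it and so is among its later
    -- neighbours, which occupy at most the first `s` positions.
    ... | h , refl with cotrans i j h hij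
    ... | inj₁ hih = inj₁ (low i (trans (G-sym (f h) (f i)) (hom i h hih)))
    ... | inj₂ hjh = inj₂ (inj₁ (low j (trans (G-sym (f h) (f j)) (hom j h hjh))))

-- Adjacency of distinct vertices in G(n,c,s), with `P` for the dominating K_s and `Q` for its union
-- with K_{c+1-2s}.
Near : {A : Set} → (A → Set) → (A → Set) → A → A → Set
Near P Q u v = P u ⊎ P v ⊎ (Q u × Q v)

<ᵇ-true : ∀ {a b} → a < b → (a <ᵇ b) ≡ true
<ᵇ-true {a} {b} lt with a <ᵇ b | <⇒<ᵇ lt
... | true | _ = refl

<ᵇ-true⁻ : ∀ {a b} → (a <ᵇ b) ≡ true → a < b
<ᵇ-true⁻ {a} {b} e = <ᵇ⇒< a b (subst IsTrue (sym e) _)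

Below : {n : ℕ} → ℕ → Fin n → Set
Below b v = toℕ v < b

module _ {n c s : ℕ} where

  Gnck-intro : ∀ {u v} → u ≢ v → Near (Below s) (Below (c + 1 ∸ s)) u v → Gnck n c s u v ≡ true
  Gnck-intro {u} {v} u≢v near with u F.≟ v
  ... | yes u≡v = ⊥-elim (u≢v u≡v)
  Gnck-intro {u} {v} u≢v (inj₁ p) | no _ rewrite <ᵇ-true p = refl
  Gnck-intro {u} {v} u≢v (inj₂ near) | no _ with toℕ u <ᵇ s
  ... | true = refl
  Gnck-intro {u} {v} u≢v (inj₂ (inj₁ p)) | no _ | false rewrite <ᵇ-true p = refl
  Gnck-intro {u} {v} u≢v (inj₂ (inj₂ (p , q))) | no _ | false with toℕ v <ᵇ s
  ... | true = refl
  ... | false rewrite <ᵇ-true p | <ᵇ-true q = refl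

  Gnck-elim : ∀ {u v} → Gnck n c s u v ≡ true → u ≢ v × Near (Below s) (Below (c + 1 ∸ s)) u v
  Gnck-elim {u} {v} e with u F.≟ v
  ... | no u≢v with toℕ u <ᵇ s in eu | toℕ v <ᵇ s in ev
  ...   | true  | _    = u≢v , inj₁ (<ᵇ-true⁻ eu)
  ...   | false | true = u≢v , inj₂ (inj₁ (<ᵇ-true⁻ ev))
  ...   | false | false with toℕ u <ᵇ (c + 1 ∸ s) in du | toℕ v <ᵇ (c + 1 ∸ s) in dv
  ...     | true | true = u≢v , inj₂ (inj₂ (<ᵇ-true⁻ du , <ᵇ-true⁻ dv))
  Gnck-elim {u} {v} () | no u≢v | false | false | true  | false
  Gnck-elim {u} {v} () | no u≢v | false | false | false | _

module _ {n c s h : ℕ} {G : Graph n} {H : Graph h} (G-sym : ∀ u v → G u v ≡ G v u)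
    (G-irrefl : ∀ v → G v v ≡ false) (cotrans : CoTransitive H) (order : PeelOrder G c s) where

  open PeelOrder order
  open Compress G G-sym G-irrefl H cotrans s base

  numCopies-compress : ∀ {N M} → NumCopies H G N → NumCopies H (Gnck n c s) M → N ≤ M
  numCopies-compress cN cM = numCopies-≤ G (Gnck n c s) cN cM R image injective
    where
    T : ℕ → List (Fin n)
    T = target [] rem
    module Π m = ListPermutation (T m) (↭-trans exhausts (target-↭ [] rem m))
    R : SubG n → SubG n → Set
    R x y = ∃ λ m → Placed (T m) (length rem) m x × y ≡ relabel (Π.π m) x
    base≡ : length base ≡ c + 1 ∸ s
    base≡ = trans (sym (m+n∸n≡m (length base) s)) (cong (_∸ s) (trans base-length (+-comm 1 c)))
    image : ∀ x → IsCopy H G x → ∃ λ y → IsCopy H (Gnck n c s) y × R x y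
    image x copy with place x copy [] rem peels (Unique-↭ exhausts (Uniqueₚ.allFin⁺ n))
                           (λ v _ → ∈-resp-↭ exhausts (∈-allFin v))
    ... | m , p = relabel (Π.π m) x , IsCopy-relabel G (Gnck n c s) x (Π.π m) copy adj , m , p , refl
      where
      adj : ∀ u v → edge x u v ≡ true → Gnck n c s (Π.π m ⟨$⟩ʳ u) (Π.π m ⟨$⟩ʳ v) ≡ true
      adj u v e = Gnck-intro
        (λ eq → false≢true (G-irrefl u) (subst (λ z → G u z ≡ true) (sym (trans (sym (inverseˡ (Π.π m))) (trans (cong (Π.π m ⟨$⟩ˡ_) eq) (inverseˡ (Π.π m))))) (edge⇒adjacent G x copy u v e)))
        (case Placed.edges p u v e of λ
          { (inj₁ q) → inj₁ (lt q) ; (inj₂ (inj₁ q)) → inj₂ (inj₁ (lt q))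
          ; (inj₂ (inj₂ (q , q′))) → inj₂ (inj₂ (lt′ q , lt′ q′)) })
        where
        lt : ∀ {w b} → position (T m) w < b → toℕ (Π.π m ⟨$⟩ʳ w) < b
        lt {w} = subst (_< _) (sym (Π.toℕ-π m w))
        lt′ : ∀ {w} → position (T m) w < length base → toℕ (Π.π m ⟨$⟩ʳ w) < c + 1 ∸ s
        lt′ q = ≤-trans (lt q) (≤-reflexive base≡)
    -- The image of `x` has a vertex at position |base| + r - m - 1, out of reach of every copy
    -- placed with a larger `m′`.
    notEarlier : ∀ {x x′ m m′} → Placed (T m) (length rem) m x → Placed (T m′) (length rem) m′ x′ →
      relabel (Π.π m) x ≡ relabel (Π.π m′) x′ → m < m′ → ⊥
    notEarlier {x} {x′} {m} {m′} p p′ eq m<m′ with Placed.top p (<-≤-trans m<m′ (Placed.m≤r p′))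
    ... | u , u∈ , e = <-irrefl e (begin-strict
        suc (position (T m) u) + m                    ≡⟨ sym (+-suc _ m) ⟩
        position (T m) u + suc m                      ≤⟨ +-monoʳ-≤ (position (T m) u) m<m′ ⟩
        position (T m) u + m′                         <⟨ +-monoˡ-< m′ (subst (_< length base + (length rem ∸ m′)) same (Placed.below p′ u′ u′∈)) ⟩
        (length base + (length rem ∸ m′)) + m′        ≡⟨ +-assoc (length base) _ m′ ⟩
        length base + ((length rem ∸ m′) + m′)        ≡⟨ cong (length base +_) (m∸n+n≡m (Placed.m≤r p′)) ⟩
        length base + length rem                      ∎)
      where
      open ≤-Reasoning
      u′ = Π.π m′ ⟨$⟩ˡ (Π.π m ⟨$⟩ʳ u)
      u′∈ : vertex x′ u′ ≡ true
      u′∈ = trans (sym (vertex-relabel (Π.π m′) x′ _)) (trans (cong (λ y → vertex y (Π.π m ⟨$⟩ʳ u)) (sym eq))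
        (trans (vertex-relabel (Π.π m) x _) (trans (cong (vertex x) (inverseˡ (Π.π m))) u∈)))
      same : position (T m′) u′ ≡ position (T m) u
      same = trans (sym (Π.toℕ-π m′ u′)) (trans (cong toℕ (inverseʳ (Π.π m′))) (Π.toℕ-π m u))
    injective : ∀ {x x′ y} → R x y → R x′ y → x ≡ x′
    injective (m , p , e) (m′ , p′ , e′) with <-cmp m m′
    ... | tri< lt _ _ = ⊥-elim (notEarlier p p′ (trans (sym e) e′) lt)
    ... | tri> _ _ lt = ⊥-elim (notEarlier p′ p (trans (sym e′) e) lt)
    ... | tri≈ _ refl _ = relabel-injective (Π.π m) (trans (sym e) e′)

-- Convexity

-- Aᵢ and Dᵢ play the roles of K_k and of K_k ∪ K_{c+1-2k} in four graphs Xᵢ; X₁ and X₂ lie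
-- between X₀ and X₃.
module _ {n h : ℕ} {H : Graph h} (cotrans : CoTransitive H)
    (A₀ A₁ A₂ A₃ D₀ D₁ D₂ D₃ : Fin n → Set) (D₀? : Decidable D₀)
    (A₁⊆A₃ : ∀ {v} → A₁ v → A₃ v) (A₂⊆A₃ : ∀ {v} → A₂ v → A₃ v)
    (A₁∩A₂⊆A₀ : ∀ {v} → A₁ v → A₂ v → A₀ v)
    (D₁⊆D₀ : ∀ {v} → D₁ v → D₀ v) (D₂⊆D₀ : ∀ {v} → D₂ v → D₀ v)
    (D₁∩D₂⊆D₃ : ∀ {v} → D₁ v → D₂ v → D₃ v)
    (A₁⊆D₀ : ∀ {v} → A₁ v → D₀ v) (A₂⊆D₀ : ∀ {v} → A₂ v → D₀ v) where

  -- If the copy has a vertex `z` outside `D₀`, every edge has an end adjacent to `z`, and such an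
  -- end is in `A` because `z` is in neither `A` nor `D`. Without such a `z` the whole copy lies in
  -- `D₀`.
  touching : ∀ x X → IsCopy H X x → (A D : Fin n → Set) → (∀ u v → edge x u v ≡ true → Near A D u v) →
    (∀ {v} → A v → D₀ v) → (∀ {v} → D v → D₀ v) → (∀ {v} → A v → A₃ v) →
    (∀ u v → edge x u v ≡ true → Near A₀ D₀ u v) ⊎ (∀ u v → edge x u v ≡ true → Near A₃ D₃ u v)
  touching x X (f , _ , _ , hS , hE) A D near A⊆D₀ D⊆D₀ A⊆A₃ with any? (λ z → (vertex x z ≟ᵇ true) ×-dec ¬? (D₀? z))
  ... | yes (z , z∈ , z∉D₀) = inj₂ λ u v e → case Equivalence.to (hE u v) e of λ
    { (i , j , refl , refl , hij) → case Equivalence.to (hS z) z∈ of λ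
      { (k , refl) → case cotrans i j k hij of λ
        { (inj₁ hik) → inj₁ (toA (Equivalence.from (hE (f i) (f k)) (i , k , refl , refl , hik)))
        ; (inj₂ hjk) → inj₂ (inj₁ (toA (Equivalence.from (hE (f j) (f k)) (j , k , refl , refl , hjk)))) } } }
    where
    toA : ∀ {u} → edge x u z ≡ true → A₃ u
    toA e with near _ z e
    ... | inj₁ a = A⊆A₃ a
    ... | inj₂ (inj₁ a) = ⊥-elim (z∉D₀ (A⊆D₀ a))
    ... | inj₂ (inj₂ (_ , d)) = ⊥-elim (z∉D₀ (D⊆D₀ d))
  ... | no none = inj₁ λ u v e → case Equivalence.to (hE u v) e of λ
    { (i , j , refl , refl , _) → inj₂ (inj₂ (inD₀ i , inD₀ j)) }
    where
    inD₀ : ∀ i → D₀ (f i)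
    inD₀ i = decidable-stable (D₀? (f i)) λ ¬d → none (f i , Equivalence.from (hS (f i)) (i , refl) , ¬d)

  -- A copy in both middle graphs is counted twice, so it has to occur in both outer graphs.
  near-∩₀ : ∀ {u v} → Near A₁ D₁ u v → Near A₂ D₂ u v → Near A₀ D₀ u v
  near-∩₀ (inj₁ a)        (inj₁ a′)        = inj₁ (A₁∩A₂⊆A₀ a a′)
  near-∩₀ (inj₁ a)        (inj₂ (inj₁ a′)) = inj₂ (inj₂ (A₁⊆D₀ a , A₂⊆D₀ a′))
  near-∩₀ (inj₁ a)        (inj₂ (inj₂ (_ , d))) = inj₂ (inj₂ (A₁⊆D₀ a , D₂⊆D₀ d))
  near-∩₀ (inj₂ (inj₁ a)) (inj₁ a′)        = inj₂ (inj₂ (A₂⊆D₀ a′ , A₁⊆D₀ a))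
  near-∩₀ (inj₂ (inj₁ a)) (inj₂ (inj₁ a′)) = inj₂ (inj₁ (A₁∩A₂⊆A₀ a a′))
  near-∩₀ (inj₂ (inj₁ a)) (inj₂ (inj₂ (d , _))) = inj₂ (inj₂ (D₂⊆D₀ d , A₁⊆D₀ a))
  near-∩₀ (inj₂ (inj₂ (d , d′))) _         = inj₂ (inj₂ (D₁⊆D₀ d , D₁⊆D₀ d′))

  near-∩₃ : ∀ {u v} → Near A₁ D₁ u v → Near A₂ D₂ u v → Near A₃ D₃ u v
  near-∩₃ (inj₁ a)        _                = inj₁ (A₁⊆A₃ a)
  near-∩₃ (inj₂ (inj₁ a)) _                = inj₂ (inj₁ (A₁⊆A₃ a))
  near-∩₃ (inj₂ (inj₂ _)) (inj₁ a)         = inj₁ (A₂⊆A₃ a)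
  near-∩₃ (inj₂ (inj₂ _)) (inj₂ (inj₁ a))  = inj₂ (inj₁ (A₂⊆A₃ a))
  near-∩₃ (inj₂ (inj₂ (d , d′))) (inj₂ (inj₂ (e , e′))) = inj₂ (inj₂ (D₁∩D₂⊆D₃ d e , D₁∩D₂⊆D₃ d′ e′))

  numCopies-convex : (X₀ X₁ X₂ X₃ : Graph n) →
    (∀ {u v} → u ≢ v → Near A₀ D₀ u v → X₀ u v ≡ true) → (∀ {u v} → u ≢ v → Near A₃ D₃ u v → X₃ u v ≡ true) →
    (∀ {u v} → X₁ u v ≡ true → u ≢ v × Near A₁ D₁ u v) → (∀ {u v} → X₂ u v ≡ true → u ≢ v × Near A₂ D₂ u v) →
    ∀ {N₀ N₁ N₂ N₃} → NumCopies H X₀ N₀ → NumCopies H X₁ N₁ → NumCopies H X₂ N₂ → NumCopies H X₃ N₃ →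
    N₁ + N₂ ≤ N₀ + N₃
  numCopies-convex X₀ X₁ X₂ X₃ intro₀ intro₃ elim₁ elim₂
    (L₀ , L₀! , _ , all₀ , refl) (L₁ , L₁! , copies₁ , _ , refl) (L₂ , L₂! , copies₂ , _ , refl) (L₃ , L₃! , _ , all₃ , refl) =
    pairwise-length-≤ _≟ˢ_ L₁! L₂! L₀! L₃!
      (λ {x} x∈ → either x X₁ (All.lookup copies₁ x∈) (λ u v e → proj₁ (adj₁ x x∈ u v e))
        (touching x X₁ (All.lookup copies₁ x∈) A₁ D₁ (λ u v e → proj₂ (adj₁ x x∈ u v e)) A₁⊆D₀ D₁⊆D₀ A₁⊆A₃))
      (λ {x} x∈ → either x X₂ (All.lookup copies₂ x∈) (λ u v e → proj₁ (adj₂ x x∈ u v e))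
        (touching x X₂ (All.lookup copies₂ x∈) A₂ D₂ (λ u v e → proj₂ (adj₂ x x∈ u v e)) A₂⊆D₀ D₂⊆D₀ A₂⊆A₃))
      both
    where
    adj₁ : ∀ x → x ∈ L₁ → ∀ u v → edge x u v ≡ true → u ≢ v × Near A₁ D₁ u v
    adj₁ x x∈ u v e = elim₁ (edge⇒adjacent X₁ x (All.lookup copies₁ x∈) u v e)
    adj₂ : ∀ x → x ∈ L₂ → ∀ u v → edge x u v ≡ true → u ≢ v × Near A₂ D₂ u v
    adj₂ x x∈ u v e = elim₂ (edge⇒adjacent X₂ x (All.lookup copies₂ x∈) u v e)
    either : ∀ x X → IsCopy H X x → (∀ u v → edge x u v ≡ true → u ≢ v) →
      (∀ u v → edge x u v ≡ true → Near A₀ D₀ u v) ⊎ (∀ u v → edge x u v ≡ true → Near A₃ D₃ u v) → x ∈ L₀ ⊎ x ∈ L₃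
    either x X copy x≢ (inj₁ near) = inj₁ (all₀ x (IsCopy-of-edges X X₀ x copy λ u v e → intro₀ (x≢ u v e) (near u v e)))
    either x X copy x≢ (inj₂ near) = inj₂ (all₃ x (IsCopy-of-edges X X₃ x copy λ u v e → intro₃ (x≢ u v e) (near u v e)))
    both : ∀ {x} → x ∈ L₁ → x ∈ L₂ → x ∈ L₀ × x ∈ L₃
    both {x} p q =
      all₀ x (IsCopy-of-edges X₁ X₀ x (All.lookup copies₁ p) λ u v e →
        intro₀ (proj₁ (adj₁ x p u v e)) (near-∩₀ (proj₂ (adj₁ x p u v e)) (proj₂ (adj₂ x q u v e)))) ,
      all₃ x (IsCopy-of-edges X₁ X₃ x (All.lookup copies₁ p) λ u v e →
        intro₃ (proj₁ (adj₁ x p u v e)) (near-∩₃ (proj₂ (adj₁ x p u v e)) (proj₂ (adj₂ x q u v e))))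

-- Exchanging i with i+1 and d with d+1 gives a second graph isomorphic to the middle one.
module Exchange {n i d : ℕ} (i+2≤d : suc (suc i) ≤ d) (d+1<n : suc d < n) where

  d<n : d < n
  d<n = <-trans (n<1+n d) d+1<n
  i+1<n : suc i < n
  i+1<n = <-trans i+2≤d d<n
  i<d : i < d
  i<d = <-trans (n<1+n i) i+2≤d
  i<n : i < n
  i<n = <-trans (n<1+n i) i+1<n

  -- `i + 2 ≤ d` keeps the two exchanged pairs disjoint. The initial segments of lengths i + 1 and d
  -- + 1 and their images then intersect in initial segments of lengths i and d, with unions of
  -- lengths i + 2 and d + 2.
  σ : Permutation′ n
  σ = transpose (fromℕ< i<n) (fromℕ< i+1<n) ∘ₚ transpose (fromℕ< d<n) (fromℕ< d+1<n)

  data Moved : ℕ → ℕ → Set where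
    up₁   : Moved i (suc i)
    down₁ : Moved (suc i) i
    up₂   : Moved d (suc d)
    down₂ : Moved (suc d) d
    fixed : ∀ {a} → a ≢ i → a ≢ suc i → a ≢ d → a ≢ suc d → Moved a a

  data Transposed (a b : ℕ) : ℕ → ℕ → Set where
    first  : Transposed a b a b
    second : Transposed a b b a
    other  : ∀ {v} → v ≢ a → v ≢ b → Transposed a b v v

  transposed : ∀ {a b} (a<n : a < n) (b<n : b < n) v →
    Transposed a b (toℕ v) (toℕ (transpose (fromℕ< b<n) (fromℕ< a<n) ⟨$⟩ˡ v))
  transposed {a} {b} a<n b<n v with v F.≟ fromℕ< a<n
  ... | yes refl = subst₂ (Transposed a b) (sym (toℕ-fromℕ< a<n)) (sym (toℕ-fromℕ< b<n)) first
  ... | no v≢a with v F.≟ fromℕ< b<n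
  ... | yes refl = subst₂ (Transposed a b) (sym (toℕ-fromℕ< b<n)) (sym (toℕ-fromℕ< a<n)) second
  ... | no v≢b = other (distinct a<n v≢a) (distinct b<n v≢b)
    where
    distinct : ∀ {e} (e<n : e < n) → v ≢ fromℕ< e<n → toℕ v ≢ e
    distinct e<n v≢ eq = v≢ (toℕ-injective (trans eq (sym (toℕ-fromℕ< e<n))))

  moved : ∀ v → Moved (toℕ v) (toℕ (σ ⟨$⟩ˡ v))
  moved v = twice (transposed d+1<n d<n v) (transposed i+1<n i<n _)
    where
    stays : ∀ {v w} → Transposed (suc i) i v w → v ≢ suc i → v ≢ i → w ≡ v
    stays first       v≢ _  = ⊥-elim (v≢ refl)
    stays second      _  v≢ = ⊥-elim (v≢ refl)
    stays (other _ _) _  _  = refl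
    twice : ∀ {u v w} → Transposed (suc d) d u v → Transposed (suc i) i v w → Moved u w
    twice first p with stays p (λ { refl → 1+n≰n i+2≤d }) (λ { refl → 1+n≰n i<d })
    ... | refl = down₂
    twice second p with stays p (λ { refl → 1+n≰n (≤-trans (n≤1+n _) i+2≤d) }) (λ { refl → <-asym i<d (n<1+n _) })
    ... | refl = up₂
    twice (other u≢d+1 u≢d) first = down₁
    twice (other u≢d+1 u≢d) second = up₁
    twice (other u≢d+1 u≢d) (other u≢i+1 u≢i) = fixed u≢i u≢i+1 u≢d u≢d+1

  -- In order, the inclusions `A₂ ⊆ A₃`, `A₁ ∩ A₂ ⊆ A₀`, `D₂ ⊆ D₀` and `D₁ ∩ D₂ ⊆ D₃` that the
  -- convexity argument requires.
  moved-< : ∀ {a b} → Moved a b → (b < suc i → a < suc (suc i)) × (a < suc i → b < suc i → a < i) ×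
    (b < suc d → a < suc (suc d)) × (a < suc d → b < suc d → a < d)
  moved-< up₁ = (λ lt → ⊥-elim (1+n≰n lt)) , (λ _ lt → ⊥-elim (1+n≰n lt)) ,
    (λ _ → m≤n⇒m≤1+n (m≤n⇒m≤1+n i<d)) , λ _ _ → i<d
  moved-< down₁ = (λ _ → ≤-refl) , (λ lt _ → ⊥-elim (1+n≰n lt)) ,
    (λ _ → m≤n⇒m≤1+n (m≤n⇒m≤1+n i+2≤d)) , λ _ _ → i+2≤d
  moved-< up₂ = (λ lt → ⊥-elim (<-asym i<d (≤-pred lt))) , (λ lt _ → ⊥-elim (<⇒≱ i<d (≤-pred lt))) ,
    (λ lt → ⊥-elim (1+n≰n lt)) , λ _ lt → ⊥-elim (1+n≰n lt)
  moved-< down₂ = (λ lt → ⊥-elim (<⇒≱ i<d (≤-pred lt))) , (λ lt _ → ⊥-elim (<-asym i<d (≤-pred lt))) ,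
    (λ _ → ≤-refl) , λ lt _ → ⊥-elim (1+n≰n lt)
  moved-< (fixed a≢i _ a≢d _) = m≤n⇒m≤1+n , (λ lt _ → ≤∧≢⇒< (≤-pred lt) a≢i) ,
    m≤n⇒m≤1+n , λ lt _ → ≤∧≢⇒< (≤-pred lt) a≢d

Gnck-intro′ : ∀ {n} c s {b} → c + 1 ∸ s ≡ b → {u v : Fin n} → u ≢ v → Near (Below s) (Below b) u v → Gnck n c s u v ≡ true
Gnck-intro′ {n} c s refl = Gnck-intro {n} {c} {s}

Gnck-elim′ : ∀ {n} c s {b} → c + 1 ∸ s ≡ b → {u v : Fin n} → Gnck n c s u v ≡ true → u ≢ v × Near (Below s) (Below b) u v
Gnck-elim′ {n} c s refl = Gnck-elim {n} {c} {s}

-- The middle count occurs once for G(n,c,i+1) and once for its image `X` under `σ`. As c = d + i +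
-- 1, the bounds c + 1 - s for s = i, i + 1, i + 2 are d + 2, d + 1 and d.
numCopies-Gnck-convex : ∀ {h} {H : Graph h} → CoTransitive H → ∀ n c i d → c ≡ d + suc i → suc (suc i) ≤ d → suc d < n →
  ∀ {N₀ N₁ N₂} → NumCopies H (Gnck n c i) N₀ → NumCopies H (Gnck n c (suc i)) N₁ →
  NumCopies H (Gnck n c (suc (suc i))) N₂ → N₁ + N₁ ≤ N₀ + N₂
numCopies-Gnck-convex {h} {H} cotrans n c i d refl i+2≤d d+1<n {N₀} {N₁} {N₂} c₀ c₁ c₂ =
  decidable-stable (N₁ + N₁ ≤? N₀ + N₂) λ ¬goal → numCopies-exists H X λ { (N , cN) →
    ¬goal (≤-trans (+-monoʳ-≤ N₁ (numCopies-≤ X₁ X c₁ cN (λ x y → y ≡ relabel σ x) image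
        λ { refl e → relabel-injective σ e }))
      (numCopies-convex cotrans
        (Below i) (Below (suc i)) (λ v → toℕ (σ ⟨$⟩ˡ v) < suc i) (Below (suc (suc i)))
        (Below (suc (suc d))) (Below (suc d)) (λ v → toℕ (σ ⟨$⟩ˡ v) < suc d) (Below d)
        (λ v → toℕ v <? suc (suc d))
        m≤n⇒m≤1+n (λ {v} → proj₁ (moved-< (moved v)))
        (λ {v} → proj₁ (proj₂ (moved-< (moved v))))
        m≤n⇒m≤1+n (λ {v} → proj₁ (proj₂ (proj₂ (moved-< (moved v)))))
        (λ {v} → proj₂ (proj₂ (proj₂ (moved-< (moved v)))))
        (λ p → ≤-trans p i+1≤d+2) (λ {v} p → ≤-trans (proj₁ (moved-< (moved v)) p) i+2≤d+2)
        (Gnck n c i) X₁ X (Gnck n c (suc (suc i)))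
        (Gnck-intro′ c i b₀) (Gnck-intro′ c (suc (suc i)) b₂) (Gnck-elim′ c (suc i) b₁) elimX c₀ c₁ cN c₂)) }
  where
  open Exchange i+2≤d d+1<n
  X₁ X : Graph n
  X₁ = Gnck n c (suc i)
  X u v = X₁ (σ ⟨$⟩ˡ u) (σ ⟨$⟩ˡ v)
  i+2≤d+2 : suc (suc i) ≤ suc (suc d)
  i+2≤d+2 = m≤n⇒m≤1+n (m≤n⇒m≤1+n i+2≤d)
  i+1≤d+2 : suc i ≤ suc (suc d)
  i+1≤d+2 = ≤-trans (n≤1+n _) i+2≤d+2
  arith₀ : ∀ d i → d + suc i + 1 ≡ suc (suc d) + i
  arith₀ = solve-∀
  arith₁ : ∀ d i → d + suc i + 1 ≡ suc d + suc i
  arith₁ = solve-∀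
  arith₂ : ∀ d i → d + suc i + 1 ≡ d + suc (suc i)
  arith₂ = solve-∀
  b₀ : d + suc i + 1 ∸ i ≡ suc (suc d)
  b₀ = trans (cong (_∸ i) (arith₀ d i)) (m+n∸n≡m (suc (suc d)) i)
  b₁ : d + suc i + 1 ∸ suc i ≡ suc d
  b₁ = trans (cong (_∸ suc i) (arith₁ d i)) (m+n∸n≡m (suc d) (suc i))
  b₂ : d + suc i + 1 ∸ suc (suc i) ≡ d
  b₂ = trans (cong (_∸ suc (suc i)) (arith₂ d i)) (m+n∸n≡m d (suc (suc i)))
  image : ∀ x → IsCopy H X₁ x → ∃ λ y → IsCopy H X y × y ≡ relabel σ x
  image x copy = relabel σ x , IsCopy-relabel X₁ X x σ copy
    (λ u v e → trans (cong₂ X₁ (inverseˡ σ {u}) (inverseˡ σ {v})) (edge⇒adjacent X₁ x copy u v e)) , refl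
  elimX : ∀ {u v} → X u v ≡ true → u ≢ v × Near (λ v → toℕ (σ ⟨$⟩ˡ v) < suc i) (λ v → toℕ (σ ⟨$⟩ˡ v) < suc d) u v
  elimX e with Gnck-elim′ c (suc i) b₁ e
  ... | u≢v , near = (λ { refl → u≢v refl }) , near

-- Once a value exceeds `a k`, convexity makes the sequence nondecreasing from there up to `t`.
convex-≤-max : (a : ℕ → ℕ) (k t : ℕ) →
  (∀ i → k ≤ i → suc (suc i) ≤ t → a (suc i) + a (suc i) ≤ a i + a (suc (suc i))) →
  ∀ s → k ≤ s → s ≤ t → a s ≤ a k ⊔ a t
convex-≤-max a k t convex s k≤s s≤t = climb (t ∸ s) s k≤s (m∸n+n≡m s≤t)
  where
  rising : ∀ j s → s ≡ j + k → suc s ≤ t → a s ≤ a k ⊎ a s ≤ a (suc s)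
  rising zero    s refl _ = inj₁ ≤-refl
  rising (suc j) (suc s) refl s+2≤t with a (suc s) ≤? a k
  ... | yes le = inj₁ le
  ... | no ¬le = inj₂ (+-cancelˡ-≤ (a (suc s)) _ _ (≤-trans (convex s (m≤n+m k j) s+2≤t)
    (+-monoˡ-≤ (a (suc (suc s))) (below (rising j s refl (≤-trans (n≤1+n _) s+2≤t))))))
    where
    below : a s ≤ a k ⊎ a s ≤ a (suc s) → a s ≤ a (suc s)
    below (inj₁ le) = ≤-trans le (<⇒≤ (≰⇒> ¬le))
    below (inj₂ le) = le
  climb : ∀ j s → k ≤ s → j + s ≡ t → a s ≤ a k ⊔ a t
  climb zero    s _   refl = m≤n⊔m (a k) (a s)
  climb (suc j) s k≤s e with rising (s ∸ k) s (sym (m∸n+n≡m k≤s)) (≤-trans (s≤s (m≤n+m s j)) (≤-reflexive e))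
  ... | inj₁ le = ≤-trans le (m≤m⊔n (a k) (a t))
  ... | inj₂ le = ≤-trans le (climb j (suc s) (m≤n⇒m≤1+n k≤s) (trans (+-suc j s) e))

-- A double negation can be moved past a quantifier over finitely many numbers, and only the counts
-- for `s` up to c/2 are compared.
finiteChoice : {R : ℕ → ℕ → Set} → (∀ s → ¬ ¬ ∃ (R s)) → ∀ t → ¬ ¬ (∃ λ a → ∀ s → s ≤ t → R s (a s))
finiteChoice {R} h zero    k = h 0 λ { (m , r) → k ((λ _ → m) , λ { zero _ → r }) }
finiteChoice {R} h (suc t) k = finiteChoice h t λ { (a , ra) → h (suc t) λ { (m , r) → k (extend a m , extended a m ra r) } }
  where
  extend : (ℕ → ℕ) → ℕ → ℕ → ℕ
  extend a m s with s ≟ suc t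
  ... | yes _ = m
  ... | no  _ = a s
  extended : ∀ a m → (∀ s → s ≤ t → R s (a s)) → R (suc t) m → ∀ s → s ≤ suc t → R s (extend a m s)
  extended a m ra r s s≤ with s ≟ suc t
  ... | yes refl = r
  ... | no  s≢   = ra s (≤-pred (≤∧≢⇒< s≤ s≢))

-- Links the counts chosen for s = k and s = t to the given `N₁` and `N₂`, which may come from other
-- lists of the same copies.
numCopies-same-≤ : ∀ {m n N M} {H : Graph m} (X : Graph n) → NumCopies H X N → NumCopies H X M → N ≤ M
numCopies-same-≤ X cN cM = numCopies-≤ X X cN cM _≡_ (λ x copy → x , copy , refl) (λ p q → trans p (sym q))

completeMultipartite-coTransitive : ∀ rs → CoTransitive (CompleteMultipartite rs)
completeMultipartite-coTransitive rs i j h ij with partOf rs i ≡ᵇ partOf rs h in ih | partOf rs j ≡ᵇ partOf rs h in jh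
... | false | _     = inj₁ refl
... | true  | false = inj₂ refl
... | true  | true  = ⊥-elim (distinct ij (trans (same ih) (sym (same jh))))
  where
  same : ∀ {a} → (a ≡ᵇ partOf rs h) ≡ true → a ≡ partOf rs h
  same {a} e = ≡ᵇ⇒≡ a _ (subst IsTrue (sym e) _)
  distinct : not (partOf rs i ≡ᵇ partOf rs j) ≡ true → partOf rs i ≢ partOf rs j
  distinct e eq with partOf rs i ≡ᵇ partOf rs j | ≡⇒≡ᵇ _ _ eq
  distinct () eq | true | _

theorem1 : (rs : List ℕ) → All (λ r → 1 ≤ r) rs →
    (n c k : ℕ) (G : Graph n) → IsSimple G → TwoConnected G → ¬ Hamiltonian G →
    Circumference G c → MinDegreeAtLeast G k →
    (N N₁ N₂ : ℕ) →
    NumCopies (CompleteMultipartite rs) G N →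
    NumCopies (CompleteMultipartite rs) (Gnck n c k) N₁ →
    NumCopies (CompleteMultipartite rs) (Gnck n c (c / 2)) N₂ →
    N ≤ N₁ ⊔ N₂
theorem1 rs _ n c k G simple@(G-sym , G-irrefl) conn ¬ham circ minDeg N N₁ N₂ cN c₁ c₂ =
  decidable-stable (N ≤? N₁ ⊔ N₂) λ ¬goal →
    peelOrder-of-nonhamiltonian G simple conn ¬ham circ minDeg λ
      { (inj₁ order) → ¬goal (≤-trans (compress order cN c₂) (m≤n⊔m N₁ N₂))
      ; (inj₂ (s , k≤s , s≤t , order)) → finiteChoice (λ s → numCopies-exists H (Gnck n c s)) t λ { (a , copies) →
          ¬goal (begin
            N           ≤⟨ compress order cN (copies s s≤t) ⟩
            a s         ≤⟨ convex-≤-max a k t (convex a copies) s k≤s s≤t ⟩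
            a k ⊔ a t   ≤⟨ ⊔-mono-≤ (numCopies-same-≤ (Gnck n c k) (copies k (≤-trans k≤s s≤t)) c₁)
                                     (numCopies-same-≤ (Gnck n c t) (copies t ≤-refl) c₂) ⟩
            N₁ ⊔ N₂     ∎) } }
  where
  open ≤-Reasoning
  H = CompleteMultipartite rs
  t = c / 2
  cotrans = completeMultipartite-coTransitive rs
  compress : ∀ {s N M} → PeelOrder G c s → NumCopies H G N → NumCopies H (Gnck n c s) M → N ≤ M
  compress order = numCopies-compress G-sym G-irrefl cotrans order
  convex : ∀ a → (∀ s → s ≤ t → NumCopies H (Gnck n c s) (a s)) → ∀ i → k ≤ i → suc (suc i) ≤ t →
    a (suc i) + a (suc i) ≤ a i + a (suc (suc i))
  convex a copies i _ i+2≤t = numCopies-Gnck-convex cotrans n c i d (sym c≡) i+2≤d d+1<n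
    (copies i (≤-trans (n≤1+n _) i+1≤t)) (copies (suc i) i+1≤t) (copies (suc (suc i)) i+2≤t)
    where
    i+1≤t : suc i ≤ t
    i+1≤t = ≤-trans (n≤1+n _) i+2≤t
    -- This leaves room for two disjoint exchanges: it gives d = c - i - 1 at least i + 2.
    2i+4≤c : suc (suc i) + suc (suc i) ≤ c
    2i+4≤c = ≤-trans (+-mono-≤ i+2≤t i+2≤t) (≤-trans (≤-reflexive (arith t)) (m/n*n≤m c 2))
      where
      arith : ∀ t → t + t ≡ t * 2
      arith = solve-∀
    d = c ∸ suc i
    c≡ : d + suc i ≡ c
    c≡ = m∸n+n≡m (≤-trans (n≤1+n (suc i)) (≤-trans (m≤m+n (suc (suc i)) (suc (suc i))) 2i+4≤c))
    i+2≤d : suc (suc i) ≤ d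
    i+2≤d = +-cancelʳ-≤ (suc i) _ _ (≤-trans (+-monoʳ-≤ (suc (suc i)) (n≤1+n (suc i))) (≤-trans 2i+4≤c (≤-reflexive (sym c≡))))
    d+1<n : suc d < n
    d+1<n = ≤-trans (s≤s (≤-trans (≤-trans (≤-reflexive (+-comm 1 d)) (+-monoʳ-≤ d (s≤s z≤n))) (≤-reflexive c≡)))
      (circumference<n {G = G} circ ¬ham)
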